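{- Let $q$ be a prime power, $k\ge 1$, and let $\mathfrak m$ be a $k$-tuple of nonnegative integers with $\mathfrak m>\mathfrak 0$. Then $$I_k(\mathfrak m)=N_k(\mathfrak m)-\sum_{(a_{\mathfrak i})}\ \prod_{\mathfrak 0<\mathfrak i<\mathfrak m}\binom{I_k(\mathfrak i)+a_{\mathfrak i}-1}{a_{\mathfrak i}},$$ where the sum is over all families $(a_{\mathfrak i})_{\mathfrak 0<\mathfrak i<\mathfrak m}$ of nonnegative integers with $\sum_{\mathfrak i}a_{\mathfrak i}\mathfrak i=\mathfrak m$. Together with $I_k(\mathfrak 0)=0$ this determines $I_k(\mathfrak m)$ recursively.
   Context: $\mathbb F_q$ is the finite field with $q$ elements. Two polynomials in $\mathbb F_q[x_1,\dots,x_k]$ are identified if they differ by a factor in $\mathbb F_q^\times$; the classes are called normalized polynomials. The vector degree of a nonzero $f$ is $\operatorname{Deg} f=(\deg_{x_1}f,\dots,\deg_{x_k}f)$. $k$-tuples of nonnegative integers are ordered componentwise, $\mathfrak 0$ is the zero tuple, and $\mathfrak a<\mathfrak b$ means $\mathfrak a\le\mathfrak b$ and $\mathfrak a\ne\mathfrak b$. $N_k(\mathfrak m)$ is the number of normalized polynomials $f\in\mathbb F_q[x_1,\dots,x_k]$ with $\operatorname{Deg} f=\mathfrak m$, and $I_k(\mathfrak m)$ is the number of those that are irreducible. $\binom{I+a-1}{a}$ is the number of multisets of size $a$ from a set of size $I$ (so it equals $1$ if $a=0$, and $0$ if $I=0<a$). -}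

module Defs where

open import Algebra.Bundles using (CommutativeRing; Semiring)
import Algebra.Definitions.RawSemiring as RawSemiringDefinitions
import Algebra.Properties.Ring as RingProperties
import Algebra.Properties.CommutativeSemigroup as CommutativeSemigroupProperties
open import Data.Fin.Base using (Fin)
open import Data.List.Base as List using (List; []; _∷_; cartesianProductWith; filter; length; upTo)
open import Data.Nat.Base using (ℕ; zero; suc; _+_; _*_; _∸_; _^_; _≤_)
open import Data.Nat.Combinatorics using (_C_)
open import Data.Nat.ListAction using (sum; product)
open import Data.Nat.Primality using (Prime)
import Data.Nat.Properties as ℕ
open import Data.Product.Base using (Σ; ∃; ∃₂; _×_; _,_; proj₁)
open import Data.Vec.Base as Vec using (Vec; []; _∷_; fromList; lookup; replicate; toList; zipWith)
open import Data.Vec.Properties using (≡-dec)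
open import Data.Vec.Relation.Binary.Pointwise.Inductive as Pointwise using (Pointwise)
open import Function.Bundles using (Inverse)
open import Level using (_⊔_) renaming (suc to lsuc)
open import Relation.Binary.Bundles using (Setoid)
import Relation.Binary.Construct.On as On
open import Relation.Binary.Definitions using (Decidable)
open import Relation.Binary.PropositionalEquality as ≡ using (_≡_; _≢_)
import Relation.Binary.Reasoning.Setoid as SetoidReasoning
open import Relation.Nullary.Decidable using (¬?; _×-dec_)
open import Relation.Nullary.Negation using (¬_)

IsPrimePower : ℕ → Set
IsPrimePower q = ∃₂ λ p n → Prime p × 1 ≤ n × q ≡ p ^ n

record FiniteField (q : ℕ) c ℓ : Set (lsuc (c ⊔ ℓ)) where
  field
    commutativeRing : CommutativeRing c ℓ
  open CommutativeRing commutativeRing public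
    renaming (_+_ to _+F_; _*_ to _*F_; -_ to -F_)
  field
    1≉0     : 1# ≉ 0#
    inverse : ∀ x → x ≉ 0# → ∃ λ y → x *F y ≈ 1#
    size    : Inverse setoid (≡.setoid (Fin q))

-- R[X] as lists of coefficients, constant term first. Trailing zeros are
-- allowed, so equality is equality of all coefficients.
module Univariate {c ℓ} (R : CommutativeRing c ℓ) where
  private module R = CommutativeRing R
  open R using (Carrier; 0#; 1#)
  open RingProperties R.ring using (-0#≈0#)
  open CommutativeSemigroupProperties R.+-commutativeSemigroup using (interchange; x∙yz≈y∙xz)

  coefficient : List Carrier → ℕ → Carrier
  coefficient []      _       = 0#
  coefficient (a ∷ f) zero    = a
  coefficient (a ∷ f) (suc n) = coefficient f n

  infix 4 _≈ₚ_
  record _≈ₚ_ (f g : List Carrier) : Set ℓ where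
    constructor coefficientwise
    field at : ∀ n → coefficient f n R.≈ coefficient g n
  open _≈ₚ_ public

  infixl 6 _+ₚ_
  _+ₚ_ : List Carrier → List Carrier → List Carrier
  []      +ₚ g       = g
  (a ∷ f) +ₚ []      = a ∷ f
  (a ∷ f) +ₚ (b ∷ g) = (a R.+ b) ∷ (f +ₚ g)

  -ₚ_ : List Carrier → List Carrier
  -ₚ_ = List.map (R.-_)

  infixr 7 _·_
  _·_ : Carrier → List Carrier → List Carrier
  a · f = List.map (a R.*_) f

  infixl 7 _*ₚ_
  _*ₚ_ : List Carrier → List Carrier → List Carrier
  []      *ₚ g = []
  (a ∷ f) *ₚ g = a · g +ₚ (0# ∷ f *ₚ g)

  private
    +-at : ∀ f g n → coefficient (f +ₚ g) n R.≈ coefficient f n R.+ coefficient g n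
    +-at []      g       n       = R.sym (R.+-identityˡ _)
    +-at (a ∷ f) []      n       = R.sym (R.+-identityʳ _)
    +-at (a ∷ f) (b ∷ g) zero    = R.refl
    +-at (a ∷ f) (b ∷ g) (suc n) = +-at f g n

    neg-at : ∀ f n → coefficient (-ₚ f) n R.≈ R.- coefficient f n
    neg-at []      n       = R.sym -0#≈0#
    neg-at (a ∷ f) zero    = R.refl
    neg-at (a ∷ f) (suc n) = neg-at f n

    ·-at : ∀ a f n → coefficient (a · f) n R.≈ a R.* coefficient f n
    ·-at a []      n       = R.sym (R.zeroʳ a)
    ·-at a (b ∷ f) zero    = R.refl
    ·-at a (b ∷ f) (suc n) = ·-at a f n

    reflₚ : ∀ {f} → f ≈ₚ f
    reflₚ = coefficientwise λ _ → R.refl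

    symₚ : ∀ {f g} → f ≈ₚ g → g ≈ₚ f
    symₚ p = coefficientwise λ n → R.sym (at p n)

    transₚ : ∀ {f g h} → f ≈ₚ g → g ≈ₚ h → f ≈ₚ h
    transₚ p q = coefficientwise λ n → R.trans (at p n) (at q n)

    setoidₚ : Setoid c ℓ
    setoidₚ = record
      { _≈_ = _≈ₚ_
      ; isEquivalence = record { refl = reflₚ ; sym = symₚ ; trans = transₚ } }

    open SetoidReasoning setoidₚ

    ∷-cong : ∀ {a b f g} → a R.≈ b → f ≈ₚ g → (a ∷ f) ≈ₚ (b ∷ g)
    ∷-cong p q = coefficientwise λ { zero → p ; (suc n) → at q n }

    0∷[]≈[] : (0# ∷ []) ≈ₚ []
    0∷[]≈[] = coefficientwise λ { zero → R.refl ; (suc n) → R.refl }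

    +-cong : ∀ {f f′ g g′} → f ≈ₚ f′ → g ≈ₚ g′ → f +ₚ g ≈ₚ f′ +ₚ g′
    +-cong {f} {f′} {g} {g′} p q = coefficientwise λ n →
      R.trans (+-at f g n) (R.trans (R.+-cong (at p n) (at q n)) (R.sym (+-at f′ g′ n)))

    +-assoc : ∀ f g h → (f +ₚ g) +ₚ h ≈ₚ f +ₚ (g +ₚ h)
    +-assoc f g h = coefficientwise λ n →
      R.trans (+-at (f +ₚ g) h n)
        (R.trans (R.+-congʳ (+-at f g n))
          (R.trans (R.+-assoc _ _ _)
            (R.sym (R.trans (+-at f (g +ₚ h) n) (R.+-congˡ (+-at g h n))))))

    +-comm : ∀ f g → f +ₚ g ≈ₚ g +ₚ f
    +-comm f g = coefficientwise λ n →
      R.trans (+-at f g n) (R.trans (R.+-comm _ _) (R.sym (+-at g f n)))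

    +-identityʳ : ∀ f → f +ₚ [] ≈ₚ f
    +-identityʳ f = +-comm f []

    +-interchange : ∀ f g h k → (f +ₚ g) +ₚ (h +ₚ k) ≈ₚ (f +ₚ h) +ₚ (g +ₚ k)
    +-interchange f g h k = coefficientwise λ n →
      R.trans (expand f g h k n)
        (R.trans (interchange _ _ _ _) (R.sym (expand f h g k n)))
      where
      expand : ∀ f g h k n → coefficient ((f +ₚ g) +ₚ (h +ₚ k)) n R.≈
        (coefficient f n R.+ coefficient g n) R.+ (coefficient h n R.+ coefficient k n)
      expand f g h k n = R.trans (+-at (f +ₚ g) (h +ₚ k) n) (R.+-cong (+-at f g n) (+-at h k n))

    -‿inverseʳ : ∀ f → f +ₚ (-ₚ f) ≈ₚ []
    -‿inverseʳ f = coefficientwise λ n →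
      R.trans (+-at f (-ₚ f) n) (R.trans (R.+-congˡ (neg-at f n)) (R.-‿inverseʳ _))

    -‿cong : ∀ {f g} → f ≈ₚ g → (-ₚ f) ≈ₚ (-ₚ g)
    -‿cong {f} {g} p = coefficientwise λ n →
      R.trans (neg-at f n) (R.trans (R.-‿cong (at p n)) (R.sym (neg-at g n)))

    ·-cong : ∀ {a b f g} → a R.≈ b → f ≈ₚ g → a · f ≈ₚ b · g
    ·-cong {a} {b} {f} {g} p q = coefficientwise λ n →
      R.trans (·-at a f n) (R.trans (R.*-cong p (at q n)) (R.sym (·-at b g n)))

    ·-distribˡ-+ : ∀ a f g → a · (f +ₚ g) ≈ₚ a · f +ₚ a · g
    ·-distribˡ-+ a f g = coefficientwise λ n →
      R.trans (·-at a (f +ₚ g) n)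
        (R.trans (R.*-congˡ (+-at f g n))
          (R.trans (R.distribˡ _ _ _)
            (R.sym (R.trans (+-at (a · f) (a · g) n) (R.+-cong (·-at a f n) (·-at a g n))))))

    ·-·-assoc : ∀ a b f → (a R.* b) · f ≈ₚ a · (b · f)
    ·-·-assoc a b f = coefficientwise λ n →
      R.trans (·-at (a R.* b) f n)
        (R.trans (R.*-assoc _ _ _)
          (R.sym (R.trans (·-at a (b · f) n) (R.*-congˡ (·-at b f n)))))

    ·-identity : ∀ f → 1# · f ≈ₚ f
    ·-identity f = coefficientwise λ n → R.trans (·-at 1# f n) (R.*-identityˡ _)

    ·-zero : ∀ f → 0# · f ≈ₚ []
    ·-zero f = coefficientwise λ n → R.trans (·-at 0# f n) (R.zeroˡ _)

    *-congˡ : ∀ f {g h} → g ≈ₚ h → f *ₚ g ≈ₚ f *ₚ h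
    *-congˡ []      p = reflₚ
    *-congˡ (a ∷ f) p = +-cong (·-cong R.refl p) (∷-cong R.refl (*-congˡ f p))

    *-zeroʳ : ∀ f → f *ₚ [] ≈ₚ []
    *-zeroʳ []      = reflₚ
    *-zeroʳ (a ∷ f) = transₚ (∷-cong R.refl (*-zeroʳ f)) 0∷[]≈[]

    *-∷ : ∀ f b g → f *ₚ (b ∷ g) ≈ₚ b · f +ₚ (0# ∷ f *ₚ g)
    *-∷ []      b g = symₚ 0∷[]≈[]
    *-∷ (a ∷ f) b g = ∷-cong (R.+-congʳ (R.*-comm a b)) (begin
      a · g +ₚ f *ₚ (b ∷ g)                 ≈⟨ +-cong reflₚ (*-∷ f b g) ⟩
      a · g +ₚ (b · f +ₚ (0# ∷ f *ₚ g))     ≈⟨ +-assoc (a · g) (b · f) _ ⟨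
      (a · g +ₚ b · f) +ₚ (0# ∷ f *ₚ g)     ≈⟨ +-cong (+-comm (a · g) (b · f)) reflₚ ⟩
      (b · f +ₚ a · g) +ₚ (0# ∷ f *ₚ g)     ≈⟨ +-assoc (b · f) (a · g) _ ⟩
      b · f +ₚ (a · g +ₚ (0# ∷ f *ₚ g))     ∎)

    *-comm : ∀ f g → f *ₚ g ≈ₚ g *ₚ f
    *-comm []      g = symₚ (*-zeroʳ g)
    *-comm (a ∷ f) g = begin
      a · g +ₚ (0# ∷ f *ₚ g)  ≈⟨ +-cong reflₚ (∷-cong R.refl (*-comm f g)) ⟩
      a · g +ₚ (0# ∷ g *ₚ f)  ≈⟨ *-∷ g a f ⟨
      g *ₚ (a ∷ f)            ∎

    *-cong : ∀ {f f′ g g′} → f ≈ₚ f′ → g ≈ₚ g′ → f *ₚ g ≈ₚ f′ *ₚ g′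
    *-cong {f} {f′} {g} {g′} p q = begin
      f *ₚ g    ≈⟨ *-congˡ f q ⟩
      f *ₚ g′   ≈⟨ *-comm f g′ ⟩
      g′ *ₚ f   ≈⟨ *-congˡ g′ p ⟩
      g′ *ₚ f′  ≈⟨ *-comm g′ f′ ⟩
      f′ *ₚ g′  ∎

    distribˡ : ∀ f g h → f *ₚ (g +ₚ h) ≈ₚ f *ₚ g +ₚ f *ₚ h
    distribˡ []      g h = reflₚ
    distribˡ (a ∷ f) g h = begin
      a · (g +ₚ h) +ₚ (0# ∷ f *ₚ (g +ₚ h))
        ≈⟨ +-cong (·-distribˡ-+ a g h) (∷-cong (R.sym (R.+-identityˡ 0#)) (distribˡ f g h)) ⟩
      (a · g +ₚ a · h) +ₚ ((0# ∷ f *ₚ g) +ₚ (0# ∷ f *ₚ h))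
        ≈⟨ +-interchange (a · g) (a · h) _ _ ⟩
      (a ∷ f) *ₚ g +ₚ (a ∷ f) *ₚ h ∎

    distribʳ : ∀ f g h → (g +ₚ h) *ₚ f ≈ₚ g *ₚ f +ₚ h *ₚ f
    distribʳ f g h = begin
      (g +ₚ h) *ₚ f      ≈⟨ *-comm (g +ₚ h) f ⟩
      f *ₚ (g +ₚ h)      ≈⟨ distribˡ f g h ⟩
      f *ₚ g +ₚ f *ₚ h   ≈⟨ +-cong (*-comm f g) (*-comm f h) ⟩
      g *ₚ f +ₚ h *ₚ f   ∎

    ·-*-assoc : ∀ a f g → (a · f) *ₚ g ≈ₚ a · (f *ₚ g)
    ·-*-assoc a []      g = reflₚ
    ·-*-assoc a (b ∷ f) g = begin
      (a R.* b) · g +ₚ (0# ∷ (a · f) *ₚ g)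
        ≈⟨ +-cong (·-·-assoc a b g) (∷-cong (R.sym (R.zeroʳ a)) (·-*-assoc a f g)) ⟩
      a · (b · g) +ₚ a · (0# ∷ f *ₚ g)
        ≈⟨ ·-distribˡ-+ a (b · g) (0# ∷ f *ₚ g) ⟨
      a · ((b ∷ f) *ₚ g) ∎

    *-assoc : ∀ f g h → (f *ₚ g) *ₚ h ≈ₚ f *ₚ (g *ₚ h)
    *-assoc []      g h = reflₚ
    *-assoc (a ∷ f) g h = begin
      (a · g +ₚ (0# ∷ f *ₚ g)) *ₚ h
        ≈⟨ distribʳ h (a · g) (0# ∷ f *ₚ g) ⟩
      (a · g) *ₚ h +ₚ (0# · h +ₚ (0# ∷ (f *ₚ g) *ₚ h))
        ≈⟨ +-cong (·-*-assoc a g h) (+-cong (·-zero h) (∷-cong R.refl (*-assoc f g h))) ⟩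
      (a ∷ f) *ₚ (g *ₚ h) ∎

    *-identityˡ : ∀ f → (1# ∷ []) *ₚ f ≈ₚ f
    *-identityˡ f = begin
      1# · f +ₚ (0# ∷ [])  ≈⟨ +-cong (·-identity f) 0∷[]≈[] ⟩
      f +ₚ []              ≈⟨ +-identityʳ f ⟩
      f                    ∎

  polynomialRing : CommutativeRing c ℓ
  polynomialRing = record
    { Carrier = List Carrier
    ; _≈_ = _≈ₚ_
    ; _+_ = _+ₚ_
    ; _*_ = _*ₚ_
    ; -_ = -ₚ_
    ; 0# = []
    ; 1# = 1# ∷ []
    ; isCommutativeRing = record
      { isRing = record
        { +-isAbelianGroup = record
          { isGroup = record
            { isMonoid = record
              { isSemigroup = record
                { isMagma = record
                  { isEquivalence = Setoid.isEquivalence setoidₚ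
                  ; ∙-cong = +-cong }
                ; assoc = +-assoc }
              ; identity = (λ _ → reflₚ) , +-identityʳ }
            ; inverse = (λ f → transₚ (+-comm (-ₚ f) f) (-‿inverseʳ f)) , -‿inverseʳ
            ; ⁻¹-cong = -‿cong }
          ; comm = +-comm }
        ; *-cong = *-cong
        ; *-assoc = *-assoc
        ; *-identity = *-identityˡ , λ f → transₚ (*-comm f (1# ∷ [])) (*-identityˡ f)
        ; distrib = distribˡ , distribʳ }
      ; *-comm = *-comm } }

-- R[x₁,…,x_k], built as (R[x₂,…,x_k])[x₁].
polynomials : ∀ {c ℓ} → CommutativeRing c ℓ → ℕ → CommutativeRing c ℓ
polynomials R zero    = R
polynomials R (suc k) = Univariate.polynomialRing (polynomials R k)

infix 4 _≤ᵛ_ _<ᵛ_ _≤ᵛ?_ _<ᵛ?_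

_≤ᵛ_ _<ᵛ_ : ∀ {k} → Vec ℕ k → Vec ℕ k → Set
a ≤ᵛ b = Pointwise _≤_ a b
a <ᵛ b = a ≤ᵛ b × a ≢ b

_≤ᵛ?_ : ∀ {k} → Decidable (_≤ᵛ_ {k})
_≤ᵛ?_ = Pointwise.decidable ℕ._≤?_

_<ᵛ?_ : ∀ {k} → Decidable (_<ᵛ_ {k})
a <ᵛ? b = (a ≤ᵛ? b) ×-dec ¬? (≡-dec ℕ._≟_ a b)

𝟎 : ∀ {k} → Vec ℕ k
𝟎 = replicate _ 0

module Multivariate {q c ℓ} (F : FiniteField q c ℓ) where
  private module F = FiniteField F
  open F using (0#; 1#; _*F_)

  Poly : ℕ → Set c
  Poly k = CommutativeRing.Carrier (polynomials F.commutativeRing k)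

  module Ring k = CommutativeRing (polynomials F.commutativeRing k)

  -- The coefficient of x₁^e₁ ⋯ x_k^e_k.
  coeff : ∀ {k} → Poly k → Vec ℕ k → F.Carrier
  coeff {zero}  a []       = a
  coeff {suc k} f (e ∷ es) =
    coeff (Univariate.coefficient (polynomials F.commutativeRing k) f e) es

  constant : ∀ k → F.Carrier → Poly k
  constant zero    a = a
  constant (suc k) a = constant k a ∷ []

  IsDegreeIn : ∀ {k} → Fin k → Poly k → ℕ → Set ℓ
  IsDegreeIn i f d =
    (∃ λ e → lookup e i ≡ d × coeff f e F.≉ 0#) ×
    (∀ e → coeff f e F.≉ 0# → lookup e i ≤ d)

  HasDeg : ∀ {k} → Poly k → Vec ℕ k → Set ℓ
  HasDeg {k} f m = ¬ Ring._≈_ k f (Ring.0# k) × (∀ i → IsDegreeIn i f (lookup m i))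

  IsIrreducible : ∀ k → Poly k → Set (c ⊔ ℓ)
  IsIrreducible k = RawSemiringDefinitions.Irreducible (Semiring.rawSemiring (Ring.semiring k))

  Associated : ∀ k → Poly k → Poly k → Set (c ⊔ ℓ)
  Associated k f g = ∃ λ a → a F.≉ 0# × Ring._≈_ k f (Ring._*_ k (constant k a) g)

  private
    constant-cong : ∀ k {a b} → a F.≈ b → Ring._≈_ k (constant k a) (constant k b)
    constant-cong zero    p = p
    constant-cong (suc k) p = Univariate.coefficientwise
      λ { zero → constant-cong k p ; (suc n) → Ring.refl k }

    constant-1 : ∀ k → Ring._≈_ k (constant k 1#) (Ring.1# k)
    constant-1 zero    = F.refl
    constant-1 (suc k) = Univariate.coefficientwise
      λ { zero → constant-1 k ; (suc n) → Ring.refl k }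

    constant-* : ∀ k a b →
      Ring._≈_ k (constant k (a *F b)) (Ring._*_ k (constant k a) (constant k b))
    constant-* zero    a b = F.refl
    constant-* (suc k) a b = Univariate.coefficientwise
      λ { zero → Ring.trans k (constant-* k a b) (Ring.sym k (Ring.+-identityʳ k _))
        ; (suc n) → Ring.refl k }

    associated-refl : ∀ k {f : Poly k} → Associated k f f
    associated-refl k {f} = 1# , F.1≉0 , sym (trans (*-congʳ (constant-1 k)) (*-identityˡ f))
      where open Ring k hiding (1#)

    associated-sym : ∀ k {f g : Poly k} → Associated k f g → Associated k g f
    associated-sym k {f} {g} (a , a≉0 , f≈ag) = b , b≉0 , sym (begin
        constant k b ⊛ f                 ≈⟨ *-congˡ f≈ag ⟩
        constant k b ⊛ (constant k a ⊛ g) ≈⟨ *-assoc _ _ _ ⟨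
        constant k b ⊛ constant k a ⊛ g  ≈⟨ *-congʳ (constant-* k b a) ⟨
        constant k (b *F a) ⊛ g          ≈⟨ *-congʳ (constant-cong k (F.trans (F.*-comm b a) ab≈1)) ⟩
        constant k 1# ⊛ g                ≈⟨ *-congʳ (constant-1 k) ⟩
        Ring.1# k ⊛ g                    ≈⟨ *-identityˡ g ⟩
        g                                ∎)
      where
      open Ring k hiding (1#; 0#) renaming (_*_ to _⊛_)
      open SetoidReasoning setoid
      b = proj₁ (F.inverse a a≉0)
      ab≈1 : a *F b F.≈ 1#
      ab≈1 = Σ.proj₂ (F.inverse a a≉0)
      b≉0 : b F.≉ 0#
      b≉0 b≈0 = F.1≉0 (F.trans (F.sym ab≈1) (F.trans (F.*-congˡ b≈0) (F.zeroʳ a)))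

    associated-trans : ∀ k {f g h : Poly k} → Associated k f g → Associated k g h → Associated k f h
    associated-trans k {f} {g} {h} (a , a≉0 , f≈ag) (b , b≉0 , g≈bh) = a *F b , ab≉0 , (begin
        f                                 ≈⟨ f≈ag ⟩
        constant k a ⊛ g                  ≈⟨ *-congˡ g≈bh ⟩
        constant k a ⊛ (constant k b ⊛ h) ≈⟨ *-assoc _ _ _ ⟨
        constant k a ⊛ constant k b ⊛ h   ≈⟨ *-congʳ (constant-* k a b) ⟨
        constant k (a *F b) ⊛ h           ∎)
      where
      open Ring k hiding (0#) renaming (_*_ to _⊛_)
      open SetoidReasoning setoid
      c′ = proj₁ (F.inverse a a≉0)
      ab≉0 : a *F b F.≉ 0#
      ab≉0 ab≈0 = b≉0 (F.trans (F.sym (F.*-identityˡ b))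
        (F.trans (F.*-congʳ (F.trans (F.sym (Σ.proj₂ (F.inverse a a≉0))) (F.*-comm a c′)))
          (F.trans (F.*-assoc c′ a b) (F.trans (F.*-congˡ ab≈0) (F.zeroʳ c′)))))

  associatedSetoid : ℕ → Setoid c (c ⊔ ℓ)
  associatedSetoid k = record
    { Carrier = Poly k
    ; _≈_ = Associated k
    ; isEquivalence = record { refl = associated-refl k ; sym = associated-sym k ; trans = associated-trans k } }

  NormalizedPolynomials : ∀ {k} → Vec ℕ k → Setoid (c ⊔ ℓ) (c ⊔ ℓ)
  NormalizedPolynomials {k} m =
    On.setoid {B = Σ (Poly k) λ f → HasDeg f m} (associatedSetoid k) proj₁

  NormalizedIrreducibles : ∀ {k} → Vec ℕ k → Setoid (c ⊔ ℓ) (c ⊔ ℓ)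
  NormalizedIrreducibles {k} m =
    On.setoid {B = Σ (Poly k) λ f → HasDeg f m × IsIrreducible k f} (associatedSetoid k) proj₁

HasCardinality : ∀ {a ℓ} → Setoid a ℓ → ℕ → Set (a ⊔ ℓ)
HasCardinality S n = Inverse S (≡.setoid (Fin n))

record Counts {q c ℓ} (F : FiniteField q c ℓ) (k : ℕ) : Set (c ⊔ ℓ) where
  open Multivariate F
  field
    N I      : Vec ℕ k → ℕ
    N-counts : ∀ m → HasCardinality (NormalizedPolynomials m) (N m)
    I-counts : ∀ m → HasCardinality (NormalizedIrreducibles m) (I m)

-- All tuples ≤ m, each once.
box : ∀ {k} → Vec ℕ k → List (Vec ℕ k)
box []      = [] ∷ []
box (n ∷ m) = cartesianProductWith _∷_ (upTo (suc n)) (box m)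

between : ∀ {k} → Vec ℕ k → List (Vec ℕ k)
between m = filter (λ i → (𝟎 <ᵛ? i) ×-dec (i <ᵛ? m)) (box m)

-- A family (aᵢ) indexed by 0 < i < m is the vector of its values, listed in
-- the order of `between m`.
Family : ∀ {k} → Vec ℕ k → Set
Family m = Vec ℕ (length (between m))

weight : ∀ {k} (m : Vec ℕ k) → Family m → Vec ℕ k
weight m a = Vec.foldr′ (zipWith _+_) 𝟎
  (zipWith (λ aᵢ i → Vec.map (aᵢ *_) i) a (fromList (between m)))

-- All families with Σ aᵢ i = m. Since every i is nonzero, aᵢ i ≤ m forces aᵢ
-- to be at most the sum of the entries of m, so the search box misses none.
families : ∀ {k} (m : Vec ℕ k) → List (Family m)
families m = filter (λ a → ≡-dec ℕ._≟_ (weight m a) m) (box (replicate _ (Vec.sum m)))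

-- The truncated subtraction matters only for n = a = 0, where 0 C 0 = 1.
multisets : ℕ → ℕ → ℕ
multisets n a = (n + a ∸ 1) C a

familyProduct : ∀ {k} → (Vec ℕ k → ℕ) → (m : Vec ℕ k) → Family m → ℕ
familyProduct J m a =
  product (toList (zipWith (λ aᵢ i → multisets (J i) aᵢ) a (fromList (between m))))

familySum : ∀ {k} → (Vec ℕ k → ℕ) → Vec ℕ k → ℕ
familySum J m = sum (List.map (familyProduct J m) (families m))

{-# OPTIONS --safe #-}

-- Over a field, irreducible polynomials in k variables are prime, by induction
-- on k: if f ∈ R[X] is irreducible of positive degree and f ∣ g h, then one
-- reduces to deg g < deg f by pseudo-division by f, and then runs the Euclidean
-- algorithm on f and g. The multipliers lie in R, and their prime factors do
-- not divide f and can be cancelled by Gauss's lemma.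
--
-- Let p₁, …, p_r be irreducible and pairwise not associated. A product of them
-- either avoids p₁ or is p₁ times such a product, and since p₁ is prime not
-- both. This recursion over the pⱼ lists every product of degree m exactly once,
-- up to units. For r irreducibles of the same degree Pascal's rule turns it into
-- a sum of the numbers of multisets, which gives the sum over families. A
-- polynomial of degree m that is not irreducible is a product of irreducibles
-- of degrees strictly between 0 and m, and an irreducible one is not.

module Submission where

open import Defs
open import Algebra.Bundles using (CommutativeRing)
open import Algebra.Definitions.RawMagma using (_,_)
import Algebra.Properties.CommutativeSemigroup as CommutativeSemigroupProperties
import Algebra.Properties.Ring as RingProperties
import Algebra.Properties.Semiring.Divisibility as SemiringDivisibility
import Algebra.Properties.Semiring.Primality as SemiringPrimality
open import Data.Bool.Base using (if_then_else_; true; false)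
open import Data.Empty using (⊥-elim)
open import Data.Fin.Base using (Fin; zero; suc)
open import Data.Fin.Permutation using (↔⇒≡)
import Data.Fin.Properties as Fin
import Data.Integer.Properties as ℤ
open import Data.List.Base as List using (List; []; _∷_; cartesianProductWith)
import Data.List.Properties as List
open import Data.List.Membership.Propositional using (_∈_; lose)
open import Data.List.Membership.Propositional.Properties
  using (∈-allFin; ∈-lookup; ∈-cartesianProductWith⁺; ∈-upTo⁺; ∈-filter⁺; ∈-filter⁻)
open import Data.List.Relation.Unary.All as All using (All; []; _∷_)
import Data.List.Relation.Unary.All.Properties as All
open import Data.List.Relation.Unary.AllPairs as AllPairs using (AllPairs; []; _∷_)
import Data.List.Relation.Unary.AllPairs.Properties as AllPairs
open import Data.List.Relation.Unary.Any as Any using (Any; here; there)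
import Data.List.Relation.Unary.Any.Properties as Any
open import Data.List.Relation.Unary.Unique.Propositional using (Unique)
import Data.List.Relation.Unary.Unique.Propositional.Properties as Unique
open import Data.Nat.Base as ℕ using (ℕ; zero; suc; _≤_; _<_; z≤n; s≤s)
open import Data.Nat.Combinatorics using (_C_; nCk+nC[k+1]≡[n+1]C[k+1]; k>n⇒nCk≡0)
open import Data.Nat.ListAction using (sum; product)
open import Data.Nat.ListAction.Properties using (sum-++)
import Data.Nat.Properties as ℕ
open import Data.Product.Base using (Σ; ∃; ∃₂; _×_; _,_; proj₁; proj₂)
open import Data.Sum.Base as Sum using (_⊎_; inj₁; inj₂; [_,_]′)
open import Data.Vec.Base as Vec using (Vec; []; _∷_; lookup; zipWith; replicate)
import Data.Vec.Properties as Vec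
open import Data.Vec.Relation.Binary.Pointwise.Inductive using ([]; _∷_)
open import Function.Base using (_∘_; id)
open import Function.Bundles using (Inverse)
import Function.Construct.Composition as Composition
import Function.Construct.Symmetry as Symmetry
open import Level using (_⊔_)
open import Relation.Binary.Bundles using (Setoid)
import Relation.Binary.Construct.On as On
open import Relation.Binary.Definitions using (tri<; tri≈; tri>)
open import Relation.Binary.PropositionalEquality as ≡ using (_≡_; _≢_)
import Relation.Binary.Reasoning.Setoid as SetoidReasoning
open import Relation.Nullary using (Dec; yes; no; does; ¬_; contradiction)
open import Relation.Nullary.Decidable as Dec using (_×-dec_; ¬?; decidable-stable)
open import Relation.Unary using (Pred; Decidable; U)

-- Divisibility in commutative rings

-- No factorization is ever written down. That a nonzero f is a product of members of `ps` up to a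
-- unit is expressed by `FactorsIn ps f`, a condition on the irreducible divisors of f only;
-- primality of irreducibles carries it from f to p f. Degrees are tracked by the degree w already
-- spent, not by the remaining m - w, so that tuples are never subtracted. An irreducible has degree
-- other than `𝟎`, so every further factor raises the total degree of w, and all sums and recursions
-- over multiplicities can be cut off at 1 + sum of m. In terms of generating functions, `adjoin`
-- multiplies by the geometric series 1 / (1 - x^d) and `adjoinMultisets n d` by (1 - x^d)^(-n),
-- both truncated; passing from the first to the second is the negative binomial expansion.
-- Divisibility, irreducibility and association have to be decided. A factor of f has at most the
-- degree of f in each variable, and there are finitely many field elements, so each of these
-- questions is settled by a finite search.

module RingLemmas {c ℓ} (R : CommutativeRing c ℓ) where
  open CommutativeRing R
  open SemiringDivisibility semiring public hiding (_,_)
  open SemiringPrimality semiring public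
  open RingProperties ring public
  open CommutativeSemigroupProperties *-commutativeSemigroup public
  open SetoidReasoning setoid

  x≈y+[x-y] : ∀ x y → x ≈ y + (x - y)
  x≈y+[x-y] x y = begin
    x              ≈⟨ +-identityʳ x ⟨
    x + 0#         ≈⟨ +-congˡ (-‿inverseˡ y) ⟨
    x + (- y + y)  ≈⟨ +-assoc x (- y) y ⟨
    (x - y) + y    ≈⟨ +-comm (x - y) y ⟩
    y + (x - y)    ∎

  difference-≈ : ∀ {x y} → x - y ≈ 0# → x ≈ y
  difference-≈ {x} {y} x-y≈0 = trans (x≈y+[x-y] x y) (trans (+-congˡ x-y≈0) (+-identityʳ y))

  module Domain (integral : ∀ {x y} → x * y ≈ 0# → x ≈ 0# ⊎ y ≈ 0#) where
    *-cancelˡ : ∀ {x y z} → x ≉ 0# → x * y ≈ x * z → y ≈ z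
    *-cancelˡ {x} {y} {z} x≉0 xy≈xz =
      [ (λ x≈0 → contradiction x≈0 x≉0) , difference-≈ ]′ (integral (begin
        x * (y - z)        ≈⟨ x[y-z]≈xy-xz x y z ⟩
        x * y - x * z      ≈⟨ +-congʳ xy≈xz ⟩
        x * z - x * z      ≈⟨ -‿inverseʳ _ ⟩
        0#                 ∎))

    *-≉0 : ∀ {x y} → x ≉ 0# → y ≉ 0# → x * y ≉ 0#
    *-≉0 x≉0 y≉0 xy≈0 = [ x≉0 , y≉0 ]′ (integral xy≈0)

  *-≉0ˡ : ∀ {x y} → x * y ≉ 0# → x ≉ 0#
  *-≉0ˡ xy≉0 x≈0 = xy≉0 (trans (*-congʳ x≈0) (zeroˡ _))

  *-≉0ʳ : ∀ {x y} → x * y ≉ 0# → y ≉ 0#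
  *-≉0ʳ xy≉0 y≈0 = xy≉0 (trans (*-congˡ y≈0) (zeroʳ _))

  ∣-+ : ∀ {x y z} → x ∣ y → x ∣ z → x ∣ y + z
  ∣-+ {x} (s , sx≈y) (t , tx≈z) = s + t , trans (distribʳ x s t) (+-cong sx≈y tx≈z)

  ∣-neg : ∀ {x y} → x ∣ y → x ∣ - y
  ∣-neg {x} (s , sx≈y) = - s , trans (sym (-‿distribˡ-* s x)) (-‿cong sx≈y)

  ∣-*ˡ : ∀ {x y} z → x ∣ y → x ∣ z * y
  ∣-*ˡ {x} z (s , sx≈y) = z * s , trans (*-assoc z s x) (*-congˡ sx≈y)

  ∣-*ʳ : ∀ {x y} z → x ∣ y → x ∣ y * z
  ∣-*ʳ {x} {y} z x∣y = ∣-respʳ (*-comm z y) (∣-*ˡ z x∣y)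

  ∣-+-cancelˡ : ∀ {x y z} → x ∣ y + z → x ∣ y → x ∣ z
  ∣-+-cancelˡ {x} {y} {z} x∣y+z x∣y = ∣-respʳ (begin
    (y + z) - y    ≈⟨ +-congʳ (+-comm y z) ⟩
    (z + y) - y    ≈⟨ +-assoc z y (- y) ⟩
    z + (y - y)    ≈⟨ +-congˡ (-‿inverseʳ y) ⟩
    z + 0#         ≈⟨ +-identityʳ z ⟩
    z              ∎) (∣-+ x∣y+z (∣-neg x∣y))

  -- Products of primes rather than of irreducibles: the factors of a multiplier are cancelled one
  -- at a time, and cancelling one uses that it is prime.
  data Factored : Carrier → Set (c ⊔ ℓ) where
    unit  : ∀ {r} → r ∣ 1# → Factored r
    prime : ∀ {r p s} → Prime p → r ≈ p * s → Factored s → Factored r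

  -- Cancellation stands in for closure under negation, which it yields on x + (- x) ≈ 0. It is the
  -- form in which a known summand is removed from a product.
  record IsAdditiveSubgroup {p} (S : Pred Carrier p) : Set (c ⊔ ℓ ⊔ p) where
    field
      ∈-resp-≈   : ∀ {x y} → x ≈ y → S x → S y
      0∈         : S 0#
      +-∈        : ∀ {x y} → S x → S y → S (x + y)
      +-cancelˡ-∈ : ∀ {x y} → S (x + y) → S x → S y

  ≈0-isAdditiveSubgroup : IsAdditiveSubgroup (_≈ 0#)
  ≈0-isAdditiveSubgroup = record
    { ∈-resp-≈    = λ x≈y x≈0 → trans (sym x≈y) x≈0
    ; 0∈          = refl
    ; +-∈         = λ x≈0 y≈0 → trans (+-cong x≈0 y≈0) (+-identityˡ 0#)
    ; +-cancelˡ-∈ = λ {x} {y} x+y≈0 x≈0 →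
        trans (sym (+-identityˡ y)) (trans (+-congʳ (sym x≈0)) x+y≈0) }

  ∣-isAdditiveSubgroup : ∀ p → IsAdditiveSubgroup (p ∣_)
  ∣-isAdditiveSubgroup p = record
    { ∈-resp-≈    = ∣-respʳ
    ; 0∈          = p ∣0
    ; +-∈         = ∣-+
    ; +-cancelˡ-∈ = ∣-+-cancelˡ }

-- Coefficients and degrees in R[X]

module UnivariateLemmas {c ℓ} (R : CommutativeRing c ℓ) where
  private
    module R = CommutativeRing R
    module RL = RingLemmas R
  open R using (0#; 1#)
  open Univariate R
  private
    module P = CommutativeRing polynomialRing
    module PL = RingLemmas polynomialRing

  coefficient-+ : ∀ f g n → coefficient (f +ₚ g) n R.≈ coefficient f n R.+ coefficient g n
  coefficient-+ []      g       n       = R.sym (R.+-identityˡ _)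
  coefficient-+ (a ∷ f) []      n       = R.sym (R.+-identityʳ _)
  coefficient-+ (a ∷ f) (b ∷ g) zero    = R.refl
  coefficient-+ (a ∷ f) (b ∷ g) (suc n) = coefficient-+ f g n

  coefficient-neg : ∀ f n → coefficient (-ₚ f) n R.≈ R.- coefficient f n
  coefficient-neg []      n       = R.sym RL.-0#≈0#
  coefficient-neg (a ∷ f) zero    = R.refl
  coefficient-neg (a ∷ f) (suc n) = coefficient-neg f n

  coefficient-· : ∀ a f n → coefficient (a · f) n R.≈ a R.* coefficient f n
  coefficient-· a []      n       = R.sym (R.zeroʳ a)
  coefficient-· a (b ∷ f) zero    = R.refl
  coefficient-· a (b ∷ f) (suc n) = coefficient-· a f n

  ∷-cong : ∀ {a b f g} → a R.≈ b → f P.≈ g → (a ∷ f) P.≈ (b ∷ g)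
  ∷-cong p q = coefficientwise λ { zero → p ; (suc n) → at q n }

  0∷[]≈[] : (0# ∷ []) P.≈ []
  0∷[]≈[] = coefficientwise λ { zero → R.refl ; (suc n) → R.refl }

  C : R.Carrier → P.Carrier
  C a = a ∷ []

  C-* : ∀ a f → C a P.* f P.≈ a · f
  C-* a f = P.trans (P.+-congˡ {a · f} 0∷[]≈[]) (P.+-identityʳ (a · f))

  coefficient-C* : ∀ a f n → coefficient (C a P.* f) n R.≈ a R.* coefficient f n
  coefficient-C* a f n = R.trans (at (C-* a f) n) (coefficient-· a f n)

  C-homo-* : ∀ a b → C (a R.* b) P.≈ C a P.* C b
  C-homo-* a b = P.sym (C-* a (C b))

  X*-cong : ∀ {f g} → f P.≈ g → (0# ∷ f) P.≈ (0# ∷ g)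
  X*-cong = ∷-cong R.refl

  *-X : ∀ f g → f P.* (0# ∷ g) P.≈ 0# ∷ f P.* g
  *-X f g = P.trans (P.*-comm f (0# ∷ g)) (P.trans
    (P.+-cong {0# · f} {[]} (coefficientwise λ n → R.trans (coefficient-· 0# f n) (R.zeroˡ _))
      (X*-cong (P.*-comm g f)))
    P.refl)

  Everywhere : ∀ {p} → Pred R.Carrier p → Pred P.Carrier p
  Everywhere S f = ∀ n → S (coefficient f n)

  module _ {p} {S : Pred R.Carrier p} (isSubgroup : RL.IsAdditiveSubgroup S) where
    private module S = RL.IsAdditiveSubgroup isSubgroup

    everywhere-isAdditiveSubgroup : PL.IsAdditiveSubgroup (Everywhere S)
    everywhere-isAdditiveSubgroup = record
      { ∈-resp-≈    = λ f≈g f∈ n → S.∈-resp-≈ (at f≈g n) (f∈ n)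
      ; 0∈          = λ _ → S.0∈
      ; +-∈         = λ {f} {g} f∈ g∈ n →
          S.∈-resp-≈ (R.sym (coefficient-+ f g n)) (S.+-∈ (f∈ n) (g∈ n))
      ; +-cancelˡ-∈ = λ {f} {g} f+g∈ f∈ n →
          S.+-cancelˡ-∈ (S.∈-resp-≈ (coefficient-+ f g n) (f+g∈ n)) (f∈ n) }

    private module S[X] = PL.IsAdditiveSubgroup everywhere-isAdditiveSubgroup

    everywhere-X : ∀ {f} → Everywhere S f → Everywhere S (0# ∷ f)
    everywhere-X f∈ zero    = S.0∈
    everywhere-X f∈ (suc n) = f∈ n

    everywhere-· : ∀ {q} {Q : Pred R.Carrier q} {a g} →
      (∀ {b} → Q b → S (a R.* b)) → Everywhere Q g → Everywhere S (a · g)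
    everywhere-· {g = g} aQ⊆S g∈ n =
      S.∈-resp-≈ (R.sym (coefficient-· _ g n)) (aQ⊆S (g∈ n))

    everywhere-* : ∀ {p q} {P : Pred R.Carrier p} {Q : Pred R.Carrier q} →
      (∀ {a b} → P a → Q b → S (a R.* b)) →
      ∀ f {g} → Everywhere P f → Everywhere Q g → Everywhere S (f P.* g)
    everywhere-* PQ⊆S []      f∈ g∈ = λ _ → S.0∈
    everywhere-* PQ⊆S (a ∷ f) {g} f∈ g∈ = S[X].+-∈ {a · g}
      (everywhere-· {g = g} (PQ⊆S (f∈ 0)) g∈)
      (everywhere-X {f P.* g} (everywhere-* PQ⊆S f (λ n → f∈ (suc n)) g∈))

    -- Gauss's lemma on contents. With P = Q = S = {0} it says that R[X] has no
    -- zero divisors, with P = Q = S = (p) that a prime p of R is prime in R[X],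
    -- and with P, Q, S given by bounds on a degree that degrees add.
    everywhere-split : ∀ {p q p̂ q̂}
      {P : Pred R.Carrier p} {P̂ : Pred R.Carrier p̂} {Q : Pred R.Carrier q} {Q̂ : Pred R.Carrier q̂} →
      P 0# → Q 0# →
      (∀ {a b} → P a → Q̂ b → S (a R.* b)) →
      (∀ {a b} → P̂ a → Q b → S (a R.* b)) →
      (∀ {a b} → P̂ a → Q̂ b → S (a R.* b) → P a ⊎ Q b) →
      ∀ f g → Everywhere P̂ f → Everywhere Q̂ g → Everywhere S (f P.* g) →
      Everywhere P f ⊎ Everywhere Q g
    everywhere-split {P = P} {P̂} {Q} {Q̂} P0 Q0 PQ̂⊆S P̂Q⊆S split = go
      where
      go : ∀ f g → Everywhere P̂ f → Everywhere Q̂ g → Everywhere S (f P.* g) →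
           Everywhere P f ⊎ Everywhere Q g
      go []      g       f∈ g∈ fg∈ = inj₁ λ _ → P0
      go (a ∷ f) []      f∈ g∈ fg∈ = inj₂ λ _ → Q0
      go (a ∷ f) (b ∷ g) f∈ g∈ fg∈ = [
          (λ a∈ → Sum.map₁ (λ f∈P → λ { zero → a∈ ; (suc n) → f∈P n })
            (go f (b ∷ g) (λ n → f∈ (suc n)) g∈
              (λ n → S[X].+-cancelˡ-∈ {a · (b ∷ g)} {0# ∷ f P.* (b ∷ g)} fg∈
                (everywhere-· {g = b ∷ g} (PQ̂⊆S a∈) g∈) (suc n)))) ,
          (λ b∈ → Sum.map₂ (λ g∈Q → λ { zero → b∈ ; (suc n) → g∈Q n })
            (go (a ∷ f) g f∈ (λ n → g∈ (suc n))
              (S[X].∈-resp-≈ (P.*-comm g (a ∷ f))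
                (λ n → S[X].+-cancelˡ-∈ {b · (a ∷ f)} {0# ∷ g P.* (a ∷ f)}
                  (S[X].∈-resp-≈ (P.*-comm (a ∷ f) (b ∷ g)) fg∈)
                  (everywhere-· {g = a ∷ f}
                    (λ a∈ → S.∈-resp-≈ (R.*-comm _ _) (P̂Q⊆S a∈ b∈)) f∈) (suc n))))) ]′
        (split (f∈ 0) (g∈ 0) (S.∈-resp-≈ (R.+-identityʳ _) (fg∈ 0)))

  -- deg f < n
  Below : ℕ → Pred P.Carrier ℓ
  Below n f = ∀ j → n ≤ j → coefficient f j R.≈ 0#

  below-isAdditiveSubgroup : ∀ n → PL.IsAdditiveSubgroup (Below n)
  below-isAdditiveSubgroup n = record
    { ∈-resp-≈    = λ f≈g f< j n≤j → R.trans (R.sym (at f≈g j)) (f< j n≤j)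
    ; 0∈          = λ _ _ → R.refl
    ; +-∈         = λ {f} {g} f< g< j n≤j →
        R.trans (coefficient-+ f g j) (Z.+-∈ (f< j n≤j) (g< j n≤j))
    ; +-cancelˡ-∈ = λ {f} {g} f+g< f< j n≤j →
        Z.+-cancelˡ-∈ (R.trans (R.sym (coefficient-+ f g j)) (f+g< j n≤j)) (f< j n≤j) }
    where module Z = RL.IsAdditiveSubgroup RL.≈0-isAdditiveSubgroup

  private module Below n = PL.IsAdditiveSubgroup (below-isAdditiveSubgroup n)

  below-mono : ∀ {m n f} → m ≤ n → Below m f → Below n f
  below-mono m≤n f< j n≤j = f< j (ℕ.≤-trans m≤n n≤j)

  below-length : ∀ f → Below (List.length f) f
  below-length []      j       _         = R.refl
  below-length (a ∷ f) (suc j) (s≤s n≤j) = below-length f j n≤j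

  below-tail : ∀ {n a f} → Below (suc n) (a ∷ f) → Below n f
  below-tail f< j n≤j = f< (suc j) (s≤s n≤j)

  below-0 : ∀ {f} → Below 0 f → f P.≈ []
  below-0 f< = coefficientwise λ n → f< n z≤n

  below-1 : ∀ {f} → Below 1 f → f P.≈ C (coefficient f 0)
  below-1 f< = coefficientwise λ { zero → R.refl ; (suc n) → f< (suc n) (s≤s z≤n) }

  below-X : ∀ {n f} → Below n f → Below (suc n) (0# ∷ f)
  below-X f< (suc j) (s≤s n≤j) = f< j n≤j

  below-· : ∀ {n f} a → Below n f → Below n (a · f)
  below-· {f = f} a f< j n≤j =
    R.trans (coefficient-· a f j) (R.trans (R.*-congˡ (f< j n≤j)) (R.zeroʳ a))

  below-C* : ∀ {n f} a → Below n f → Below n (C a P.* f)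
  below-C* {n} {f} a f< = Below.∈-resp-≈ n (P.sym (C-* a f)) (below-· {f = f} a f<)

  -- With deg f ≤ m but deg g < n the bound m + n needs no predecessor, and g = 0 is covered by n =
  -- 0.
  below-* : ∀ {m n} f {g} → Below (suc m) f → Below n g → Below (m ℕ.+ n) (f P.* g)
  below-* []      f< g< _ _ = R.refl
  below-* {zero} {n} (a ∷ f) {g} f< g< = Below.+-∈ n {a · g} (below-· {f = g} a g<)
    (Below.∈-resp-≈ n (P.sym (P.trans (X*-cong (P.*-congʳ {g} (below-0 {f} (below-tail {f = f} f<))))
      0∷[]≈[])) (Below.0∈ n))
  below-* {suc m} {n} (a ∷ f) {g} f< g< = Below.+-∈ (suc m ℕ.+ n) {a · g}
    (below-· {f = g} a (below-mono {f = g} (ℕ.m≤n+m n (suc m)) g<))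
    (below-X {f = f P.* g} (below-* f (below-tail {f = f} f<) g<))

  leading-* : ∀ {m n} f {g} → Below (suc m) f → Below (suc n) g →
    coefficient (f P.* g) (m ℕ.+ n) R.≈ coefficient f m R.* coefficient g n
  leading-* []  f< g< = R.sym (R.zeroˡ _)
  leading-* {zero} {n} (a ∷ f) {g} f< g< = R.trans
    (at (P.+-congˡ {a · g} (P.trans (X*-cong (P.*-congʳ {g} (below-0 {f} (below-tail {f = f} f<)))) 0∷[]≈[])) n)
    (R.trans (at (P.+-identityʳ (a · g)) n) (coefficient-· a g n))
  leading-* {suc m} {n} (a ∷ f) {g} f< g< = R.trans
    (coefficient-+ (a · g) (0# ∷ f P.* g) (suc m ℕ.+ n))
    (R.trans (R.+-cong (below-· {f = g} a g< (suc m ℕ.+ n) (s≤s (ℕ.m≤n+m n m)))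
        (leading-* f (below-tail {f = f} f<) g<))
      (R.+-identityˡ _))

  below-improve : ∀ {n f} → Below (suc n) f → coefficient f n R.≈ 0# → Below n f
  below-improve {n} f< fₙ≈0 j n≤j with ℕ.m≤n⇒m<n∨m≡n n≤j
  ... | inj₁ n<j    = f< j n<j
  ... | inj₂ ≡.refl = fₙ≈0

  HasDegree : ℕ → Pred P.Carrier ℓ
  HasDegree d f = Below (suc d) f × coefficient f d R.≉ 0#

  hasDegree⇒≉0 : ∀ {d f} → HasDegree d f → f P.≉ []
  hasDegree⇒≉0 {d} (_ , f_d≉0) f≈0 = f_d≉0 (at f≈0 d)

  hasDegree-C : ∀ {a} → a R.≉ 0# → HasDegree 0 (C a)
  hasDegree-C a≉0 = (λ { (suc j) _ → R.refl }) , a≉0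

  module DecidableZero (_≈0? : ∀ a → Dec (a R.≈ 0#)) where
    []? : ∀ f → Dec (f P.≈ [])
    []? [] = yes P.refl
    []? (a ∷ f) with a ≈0? | []? f
    ... | yes a≈0 | yes f≈0 = yes (P.trans (∷-cong a≈0 f≈0) 0∷[]≈[])
    ... | no a≉0  | _       = no λ p → a≉0 (at p 0)
    ... | yes _   | no f≉0  = no λ p → f≉0 (coefficientwise λ n → at p (suc n))

    below⇒degree : ∀ n {f} → Below n f → f P.≈ [] ⊎ ∃ λ d → d < n × HasDegree d f
    below⇒degree zero    f< = inj₁ (below-0 f<)
    below⇒degree (suc n) {f} f< with coefficient f n ≈0?
    ... | no fₙ≉0  = inj₂ (n , ℕ.≤-refl , f< , fₙ≉0)
    ... | yes fₙ≈0 = Sum.map₂ (λ (d , d<n , p) → d , ℕ.m<n⇒m<1+n d<n , p)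
      (below⇒degree n (below-improve {f = f} f< fₙ≈0))

    degree : ∀ f → f P.≈ [] ⊎ ∃ λ d → HasDegree d f
    degree f = Sum.map₂ (λ (d , _ , p) → d , p) (below⇒degree _ (below-length f))

  module Domain (integral : ∀ {a b} → a R.* b R.≈ 0# → a R.≈ 0# ⊎ b R.≈ 0#) where

    integral[X] : ∀ {f g} → f P.* g P.≈ [] → f P.≈ [] ⊎ g P.≈ []
    integral[X] {f} {g} fg≈0 = Sum.map coefficientwise coefficientwise
      (everywhere-split RL.≈0-isAdditiveSubgroup {P̂ = U} {Q̂ = U} R.refl R.refl
        (λ a≈0 _ → R.trans (R.*-congʳ a≈0) (R.zeroˡ _))
        (λ _ b≈0 → R.trans (R.*-congˡ b≈0) (R.zeroʳ _))
        (λ _ _ → integral) f g _ _ (at fg≈0))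

    hasDegree-* : ∀ {m n} f {g} → HasDegree m f → HasDegree n g → HasDegree (m ℕ.+ n) (f P.* g)
    hasDegree-* {m} {n} f {g} (f< , fₘ≉0) (g< , gₙ≉0) =
      (λ j m+n<j → below-* f f< g< j (ℕ.≤-trans (ℕ.≤-reflexive (ℕ.+-suc m n)) m+n<j)) ,
      λ p → [ fₘ≉0 , gₙ≉0 ]′ (integral (R.trans (R.sym (leading-* f f< g<)) p))

  -- Brings divisibility by a constant into the coefficientwise form that `everywhere-split`
  -- requires.
  ∣C⇒everywhere : ∀ {a f} → C a PL.∣ f → Everywhere (a RL.∣_) f
  ∣C⇒everywhere {a} {f} (q , qa≈f) n = RL.∣-respʳ (at qa≈f n)
    (RL.∣-respʳ (R.trans (R.sym (coefficient-C* a q n)) (at (P.*-comm (C a) q) n))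
      (coefficient q n , R.*-comm _ _))

  everywhere⇒∣C : ∀ {a} f → Everywhere (a RL.∣_) f → C a PL.∣ f
  everywhere⇒∣C []      f∈ = PL._∣0 _
  everywhere⇒∣C {a} (b ∷ f) f∈ with f∈ 0 | everywhere⇒∣C f (λ n → f∈ (suc n))
  ... | (s , sa≈b) | (t , tC≈f) = (s ∷ t) , P.trans (P.*-comm (s ∷ t) (C a)) (P.trans (C-* a (s ∷ t))
    (∷-cong (R.trans (R.*-comm a s) sa≈b)
      (P.trans (P.sym (C-* a t)) (P.trans (P.*-comm (C a) t) tC≈f))))

  C-∣ : ∀ {a b} → a RL.∣ b → C a PL.∣ C b
  C-∣ {a} {b} a∣b = everywhere⇒∣C (C b) λ { zero → a∣b ; (suc n) → RL._∣0 a }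

  C-prime : ∀ {p} → RL.Prime p → PL.Prime (C p)
  C-prime {p} (SemiringPrimality.mkPrime p≉0 p∤1 split) = PL.mkPrime
    (λ p≈0 → p≉0 (at p≈0 0))
    (λ p∣1 → p∤1 (∣C⇒everywhere p∣1 0))
    (λ {f} {g} p∣fg → Sum.map (everywhere⇒∣C f) (everywhere⇒∣C g)
      (everywhere-split (RL.∣-isAdditiveSubgroup p) {P̂ = U} {Q̂ = U} (RL._∣0 p) (RL._∣0 p)
        (λ {a} {b} p∣a _ → RL.∣-*ʳ b p∣a)
        (λ {a} {b} _ p∣b → RL.∣-*ˡ a p∣b)
        (λ _ _ → split) f g _ _ (∣C⇒everywhere p∣fg)))

-- Irreducible elements of R[X] are prime when R is factorial

module GaussLemma {c ℓ} (R : CommutativeRing c ℓ)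
  (_≈0? : ∀ a → Dec (CommutativeRing._≈_ R a (CommutativeRing.0# R)))
  (integral : ∀ {a b} → CommutativeRing._≈_ R (CommutativeRing._*_ R a b) (CommutativeRing.0# R) →
    CommutativeRing._≈_ R a (CommutativeRing.0# R) ⊎ CommutativeRing._≈_ R b (CommutativeRing.0# R))
  (factored : ∀ {a} → CommutativeRing._≉_ R a (CommutativeRing.0# R) → RingLemmas.Factored R a)
  where
  private
    module R = CommutativeRing R
    module RL = RingLemmas R
    module RD = RL.Domain integral
  open R using (0#; 1#)
  open Univariate R
  open UnivariateLemmas R
  open DecidableZero _≈0?
  open Domain integral
  private
    module P = CommutativeRing polynomialRing
    module PL = RingLemmas polynomialRing
    module PD = PL.Domain integral[X]
  open SetoidReasoning P.setoid

  hasDegree-unique : ∀ {m n f} → HasDegree m f → HasDegree n f → m ≡ n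
  hasDegree-unique {m} {n} (f<m , fₘ≉0) (f<n , fₙ≉0) with ℕ.<-cmp m n
  ... | tri< m<n _ _ = contradiction (f<m n m<n) fₙ≉0
  ... | tri≈ _ m≡n _ = m≡n
  ... | tri> _ _ n<m = contradiction (f<n m n<m) fₘ≉0

  hasDegree-resp-≈ : ∀ {d f g} → f P.≈ g → HasDegree d f → HasDegree d g
  hasDegree-resp-≈ {d} f≈g (f< , f_d≉0) =
    PL.IsAdditiveSubgroup.∈-resp-≈ (below-isAdditiveSubgroup (suc d)) f≈g f< ,
    λ g_d≈0 → f_d≉0 (R.trans (at f≈g d) g_d≈0)

  ≉0⇒1≉0 : ∀ {a} → a R.≉ 0# → 1# R.≉ 0#
  ≉0⇒1≉0 {a} a≉0 1≈0 = a≉0 (R.trans (R.sym (R.*-identityˡ a)) (R.trans (R.*-congʳ 1≈0) (R.zeroˡ a)))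

  unit-hasDegree-0 : ∀ {d f} → HasDegree d f → f PL.∣ P.1# → d ≡ 0
  unit-hasDegree-0 {d} {f} hd@(_ , f_d≉0) (g , gf≈1) with degree g
  ... | inj₁ g≈0 = contradiction
    (at (P.trans (P.sym gf≈1) (P.trans (P.*-congʳ {f} g≈0) (P.zeroˡ f))) 0) (≉0⇒1≉0 f_d≉0)
  ... | inj₂ (e , he) = ℕ.m+n≡0⇒n≡0 e (hasDegree-unique {f = P.1#}
    (hasDegree-resp-≈ gf≈1 (hasDegree-* g {f} he hd)) (hasDegree-C (≉0⇒1≉0 f_d≉0)))

  unit-below-1 : ∀ {f} → f PL.∣ P.1# → Below 1 f
  unit-below-1 {f} f∣1 with degree f
  ... | inj₁ f≈0 = λ j _ → at f≈0 j
  ... | inj₂ (d , hd) with ≡.refl ← unit-hasDegree-0 hd f∣1 = proj₁ hd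

  C-inverse : ∀ {a b} → b R.* a R.≈ 1# → ∀ f → C b P.* (C a P.* f) P.≈ f
  C-inverse {a} {b} ba≈1 f = begin
    C b P.* (C a P.* f)  ≈⟨ P.*-assoc (C b) (C a) f ⟨
    C b P.* C a P.* f    ≈⟨ P.*-congʳ {f} (C-homo-* b a) ⟨
    C (b R.* a) P.* f    ≈⟨ P.*-congʳ {f} (∷-cong ba≈1 (P.refl {[]})) ⟩
    P.1# P.* f           ≈⟨ P.*-identityˡ f ⟩
    f                    ∎

  C-homo-*-assoc : ∀ {a b r} f → r R.≈ a R.* b → C r P.* f P.≈ C a P.* (C b P.* f)
  C-homo-*-assoc {a} {b} {r} f r≈ab = begin
    C r P.* f            ≈⟨ P.*-congʳ {f} (∷-cong r≈ab (P.refl {[]})) ⟩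
    C (a R.* b) P.* f    ≈⟨ P.*-congʳ {f} (C-homo-* a b) ⟩
    C a P.* C b P.* f    ≈⟨ P.*-assoc (C a) (C b) f ⟩
    C a P.* (C b P.* f)  ∎

  -- The leading coefficient l of f need not be invertible, so g is multiplied by a power of l, one
  -- factor for each entry of its coefficient list. From c g ≈ f q + r follows c (a + X g) ≈ f (X q)
  -- + y, where y = c a + X r has degree at most d.
  pseudoDivide : ∀ {d f} → HasDegree d f → ∀ g →
    ∃ λ c → c R.≉ 0# × ∃₂ λ q r → C c P.* g P.≈ f P.* q P.+ r × Below d r
  pseudoDivide {d} {f} (f< , f_d≉0) [] = 1# , ≉0⇒1≉0 f_d≉0 , [] , [] ,
    P.trans (P.*-identityˡ []) (P.sym (P.trans (P.+-identityʳ (f P.* [])) (P.zeroʳ f))) , λ _ _ → R.refl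
  pseudoDivide {d} {f} hd@(f< , l≉0) (a ∷ g) with pseudoDivide {f = f} hd g
  ... | c , c≉0 , q , r , cg≈fq+r , r< =
    l R.* c , RD.*-≉0 l≉0 c≉0 , C l P.* X P.+ C t , r′ , eq , r′<
    where
    X y r′ : P.Carrier
    l t : R.Carrier
    l = coefficient f d
    X = 0# ∷ q
    y = (c R.* a) ∷ r
    t = coefficient y d
    -- Both terms have the coefficient l t at d, so the degree drops below d.
    r′ = C l P.* y P.- C t P.* f
    eq : C (l R.* c) P.* (a ∷ g) P.≈ f P.* (C l P.* X P.+ C t) P.+ r′
    eq = begin
      C (l R.* c) P.* (a ∷ g)
        ≈⟨ C-homo-*-assoc (a ∷ g) R.refl ⟩
      C l P.* (C c P.* (a ∷ g))
        ≈⟨ P.*-congˡ {C l} (C-* c (a ∷ g)) ⟩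
      C l P.* (c R.* a ∷ c · g)
        ≈⟨ P.*-congˡ {C l} (∷-cong (R.sym (R.+-identityˡ _)) (P.trans (P.sym (C-* c g)) cg≈fq+r)) ⟩
      C l P.* ((0# ∷ f P.* q) P.+ y)
        ≈⟨ P.*-congˡ {C l} (P.+-congʳ {y} (P.sym (*-X f q))) ⟩
      C l P.* (f P.* X P.+ y)
        ≈⟨ P.distribˡ (C l) (f P.* X) y ⟩
      C l P.* (f P.* X) P.+ C l P.* y
        ≈⟨ P.+-cong (PL.x∙yz≈y∙xz (C l) f X) (PL.x≈y+[x-y] (C l P.* y) (C t P.* f)) ⟩
      f P.* (C l P.* X) P.+ (C t P.* f P.+ r′)
        ≈⟨ P.+-assoc (f P.* (C l P.* X)) (C t P.* f) r′ ⟨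
      f P.* (C l P.* X) P.+ C t P.* f P.+ r′
        ≈⟨ P.+-congʳ {r′} (P.+-congˡ {f P.* (C l P.* X)} (P.*-comm (C t) f)) ⟩
      f P.* (C l P.* X) P.+ f P.* C t P.+ r′
        ≈⟨ P.+-congʳ {r′} (P.distribˡ f (C l P.* X) (C t)) ⟨
      f P.* (C l P.* X P.+ C t) P.+ r′ ∎
    module B = PL.IsAdditiveSubgroup (below-isAdditiveSubgroup (suc d))
    y< : Below (suc d) y
    y< (suc j) (s≤s d≤j) = r< j d≤j
    neg-below : ∀ {n f} → Below n f → Below n (P.- f)
    neg-below {f = f} f< j n≤j =
      R.trans (coefficient-neg f j) (R.trans (R.-‿cong (f< j n≤j)) RL.-0#≈0#)
    r′< : Below d r′
    r′< = below-improve {f = r′} (B.+-∈ {C l P.* y} {P.- (C t P.* f)} (below-C* {f = y} l y<)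
        (neg-below {f = C t P.* f} (below-C* {f = f} t f<)))
      (R.trans (coefficient-+ (C l P.* y) (P.- (C t P.* f)) d)
        (R.trans (R.+-cong (coefficient-C* l y d)
            (R.trans (coefficient-neg (C t P.* f) d) (R.-‿cong (coefficient-C* t f d))))
          (R.trans (R.+-congʳ (R.*-comm l t)) (R.-‿inverseʳ _))))

  module PositiveDegree {D f} (f-irreducible : PL.Irreducible f) (f-degree : HasDegree (suc D) f) where
    open PL.Irreducible f-irreducible

    private
      f≉0 : f P.≉ []
      f≉0 = hasDegree⇒≉0 {suc D} {f} f-degree

    -- If f ≈ g p, one factor is a unit: not p, which is prime, and not g, since f would then be
    -- constant. So f is primitive.
    prime-constant∤ : ∀ {p} → RL.Prime p → ¬ C p PL.∣ f
    prime-constant∤ {p} p-prime (g , gp≈f) with split-∣1 (P.sym gp≈f)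
    ... | inj₂ p∣1 = PL.Prime.p∤1 (C-prime p-prime) p∣1
    ... | inj₁ g∣1 = proj₂ f-degree (f<1 (suc D) (s≤s z≤n))
      where
      f<1 : Below 1 f
      f<1 = PL.IsAdditiveSubgroup.∈-resp-≈ (below-isAdditiveSubgroup 1)
        (P.trans (P.*-comm (C p) g) gp≈f) (below-C* {f = g} p (unit-below-1 {g} g∣1))

    -- In w f ≈ r h a prime factor p of r divides w f but not f, hence it divides w and cancels on
    -- both sides.
    ∣C*⇒∣ : ∀ {r h} → RL.Factored r → f PL.∣ C r P.* h → f PL.∣ h
    ∣C*⇒∣ {r} {h} (RL.unit (s , sr≈1)) f∣rh = PL.∣-respʳ (C-inverse sr≈1 h) (PL.∣-*ˡ (C s) f∣rh)
    ∣C*⇒∣ {r} {h} (RL.prime {p = p} {s} p-prime r≈ps s-factored) (w , wf≈rh)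
      with PL.Prime.split-∣ (C-prime p-prime) {w} {f}
        (PL.∣-respʳ (P.sym (P.trans wf≈rh (C-homo-*-assoc h r≈ps)))
          (PL.∣-*ʳ (C s P.* h) (PL.∣-refl {C p})))
    ... | inj₂ p∣f = contradiction p∣f (prime-constant∤ p-prime)
    ... | inj₁ (v , vp≈w) = ∣C*⇒∣ s-factored (v , PD.*-cancelˡ {C p}
      (PL.Prime.p≉0 (C-prime p-prime)) (begin
        C p P.* (v P.* f)    ≈⟨ PL.x∙yz≈yx∙z (C p) v f ⟩
        v P.* C p P.* f      ≈⟨ P.*-congʳ {f} vp≈w ⟩
        w P.* f              ≈⟨ wf≈rh ⟩
        C r P.* h            ≈⟨ C-homo-*-assoc h r≈ps ⟩
        C p P.* (C s P.* h)  ∎))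

    -- An irreducible f stays irreducible over the field of fractions. Each prime factor of r
    -- divides g or h and is cancelled there; once r is a unit, the irreducibility of f itself
    -- applies.
    C*-split : ∀ {r g h} → RL.Factored r → C r P.* f P.≈ g P.* h → Below 1 g ⊎ Below 1 h
    C*-split {r} {g} {h} (RL.unit (s , sr≈1)) rf≈gh
      with split-∣1 {C s P.* g} {h} (begin
        f                    ≈⟨ C-inverse sr≈1 f ⟨
        C s P.* (C r P.* f)  ≈⟨ P.*-congˡ {C s} rf≈gh ⟩
        C s P.* (g P.* h)    ≈⟨ P.*-assoc (C s) g h ⟨
        C s P.* g P.* h      ∎)
    ... | inj₁ sg∣1 = inj₁ (unit-below-1 (PL.∣-trans (C s , P.refl) sg∣1))
    ... | inj₂ h∣1  = inj₂ (unit-below-1 h∣1)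
    C*-split {r} {g} {h} (RL.prime {p = p} {s} p-prime r≈ps s-factored) rf≈gh
      with PL.Prime.split-∣ (C-prime p-prime) {g} {h}
        (PL.∣-respʳ (P.sym (P.trans (P.sym rf≈gh) (C-homo-*-assoc f r≈ps)))
          (PL.∣-*ʳ (C s P.* f) (PL.∣-refl {C p})))
    ... | inj₁ (g′ , g′p≈g) = Sum.map₁
      (λ g′< → PL.IsAdditiveSubgroup.∈-resp-≈ (below-isAdditiveSubgroup 1)
        (P.trans (P.*-comm (C p) g′) g′p≈g) (below-C* {f = g′} p g′<))
      (C*-split {g = g′} {h} s-factored (PD.*-cancelˡ {C p}
        (PL.Prime.p≉0 (C-prime p-prime)) (begin
          C p P.* (C s P.* f)    ≈⟨ C-homo-*-assoc f r≈ps ⟨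
          C r P.* f              ≈⟨ rf≈gh ⟩
          g P.* h                ≈⟨ P.*-congʳ {h} g′p≈g ⟨
          g′ P.* C p P.* h       ≈⟨ PL.x∙yz≈yx∙z (C p) g′ h ⟨
          C p P.* (g′ P.* h)     ∎)))
    ... | inj₂ (h′ , h′p≈h) = Sum.map₂
      (λ h′< → PL.IsAdditiveSubgroup.∈-resp-≈ (below-isAdditiveSubgroup 1)
        (P.trans (P.*-comm (C p) h′) h′p≈h) (below-C* {f = h′} p h′<))
      (C*-split {g = g} {h′} s-factored (PD.*-cancelˡ {C p}
        (PL.Prime.p≉0 (C-prime p-prime)) (begin
          C p P.* (C s P.* f)    ≈⟨ C-homo-*-assoc f r≈ps ⟨
          C r P.* f              ≈⟨ rf≈gh ⟩
          g P.* h                ≈⟨ P.*-congˡ {g} h′p≈h ⟨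
          g P.* (h′ P.* C p)     ≈⟨ PL.x∙yz≈z∙xy g h′ (C p) ⟩
          C p P.* (g P.* h′)     ∎)))

    ∣-below⇒≈0 : ∀ {g} → Below (suc D) g → f PL.∣ g → g P.≈ []
    ∣-below⇒≈0 {g} g< (u , uf≈g) with degree u
    ... | inj₁ u≈0 = P.trans (P.sym uf≈g) (P.trans (P.*-congʳ {f} u≈0) (P.zeroˡ f))
    ... | inj₂ (e , he) = contradiction (g< (e ℕ.+ suc D) (ℕ.m≤n+m (suc D) e))
      (proj₂ (hasDegree-resp-≈ uf≈g (hasDegree-* u {f} he f-degree)))

    -- A Euclidean step: as f ∣ g * h, f also divides r * h, where the remainder r
    -- of c f modulo g has smaller degree than g.
    split-leading : ∀ n → suc n ≤ suc D →
      (∀ {g h} → Below n g → f PL.∣ g P.* h → f PL.∣ g ⊎ f PL.∣ h) →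
      ∀ {g h} → HasDegree n g → f PL.∣ g P.* h → f PL.∣ h
    -- A nonzero constant g is a product of primes of R and a unit, all of which cancel.
    split-leading zero    _   _         {g} {h} (g< , g₀≉0) f∣gh =
      ∣C*⇒∣ (factored g₀≉0) (PL.∣-respʳ (P.*-congʳ {h} (below-1 {g} g<)) f∣gh)
    split-leading n@(suc _) n<D split-low {g} {h} (g< , gₙ≉0) f∣gh
      with pseudoDivide {f = g} (g< , gₙ≉0) f
    ... | c , c≉0 , q , r , cf≈gq+r , r< =
      [ (λ f∣r → contradiction f∣r f∤r) , id ]′ (split-low r< f∣rh)
      where
      f∣rh : f PL.∣ r P.* h
      f∣rh = PL.∣-+-cancelˡ
        (PL.∣-respʳ (begin
            C c P.* f P.* h                  ≈⟨ P.*-congʳ {h} cf≈gq+r ⟩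
            (g P.* q P.+ r) P.* h            ≈⟨ P.distribʳ h (g P.* q) r ⟩
            g P.* q P.* h P.+ r P.* h        ∎)
          (PL.∣-*ʳ h (PL.∣-*ˡ (C c) (PL.∣-refl {f}))))
        (PL.∣-respʳ (PL.x∙yz≈yx∙z q g h) (PL.∣-*ˡ q f∣gh))
      -- Otherwise r ≈ 0 by degree and c f ≈ g q, so that g or q is constant. But g has degree n >
      -- 0, and a constant q would give f a degree of at most n, which is less than D + 1.
      f∤r : ¬ f PL.∣ r
      f∤r f∣r = [ (λ g<1 → gₙ≉0 (g<1 n (s≤s z≤n))) , q≮1 ]′ (C*-split {g = g} {q} (factored c≉0) cf≈gq)
        where
        cf≈gq : C c P.* f P.≈ g P.* q
        cf≈gq = P.trans cf≈gq+r (P.trans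
          (P.+-congˡ {g P.* q} (∣-below⇒≈0 (below-mono {f = r} (ℕ.<⇒≤ n<D) r<) f∣r)) (P.+-identityʳ (g P.* q)))
        q≮1 : ¬ Below 1 q
        q≮1 q<1 = RD.*-≉0 c≉0 (proj₂ f-degree) (R.trans (R.sym (coefficient-C* c f (suc D)))
          (R.trans (at cf≈gq (suc D))
            (below-* g g< q<1 (suc D) (ℕ.≤-trans (ℕ.≤-reflexive (ℕ.+-comm n 1)) n<D))))

    -- Recursion on the bound: either the coefficient at n vanishes and the bound drops, or a
    -- Euclidean step leads to a remainder below n. At bound 0 only g ≈ 0 is left, which f divides.
    split-low : ∀ n → n ≤ suc D → ∀ {g h} → Below n g → f PL.∣ g P.* h → f PL.∣ g ⊎ f PL.∣ h
    split-low zero    _   g< _ = inj₁ (PL.∣-respʳ (P.sym (below-0 g<)) (PL._∣0 f))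
    split-low (suc n) n<D {g} {h} g< f∣gh with coefficient g n ≈0?
    ... | yes gₙ≈0 = split-low n (ℕ.<⇒≤ n<D) (below-improve {f = g} g< gₙ≈0) f∣gh
    ... | no  gₙ≉0 = inj₂ (split-leading n n<D (split-low n (ℕ.<⇒≤ n<D)) {g} (g< , gₙ≉0) f∣gh)

    positiveDegree-prime : PL.Prime f
    positiveDegree-prime = PL.mkPrime f≉0 p∤1 split
      where
      split : ∀ {g h} → f PL.∣ g P.* h → f PL.∣ g ⊎ f PL.∣ h
      split {g} {h} f∣gh with pseudoDivide {f = f} f-degree g
      ... | c , c≉0 , q , r , cg≈fq+r , r< = Sum.map₁
        (λ f∣r → ∣C*⇒∣ (factored c≉0) (PL.∣-respʳ (P.sym cg≈fq+r) (PL.∣-+ (PL.∣-*ʳ q (PL.∣-refl {f})) f∣r)))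
        (split-low (suc D) ℕ.≤-refl r< (PL.∣-+-cancelˡ
          (PL.∣-respʳ (begin
              C c P.* (g P.* h)                ≈⟨ P.*-assoc (C c) g h ⟨
              C c P.* g P.* h                  ≈⟨ P.*-congʳ {h} cg≈fq+r ⟩
              (f P.* q P.+ r) P.* h            ≈⟨ P.distribʳ h (f P.* q) r ⟩
              f P.* q P.* h P.+ r P.* h        ∎)
            (PL.∣-*ˡ (C c) f∣gh))
          (PL.∣-*ʳ h (PL.∣-*ʳ q (PL.∣-refl {f})))))

  ∣-prime : ∀ {p f} → PL.Prime p → f PL.∣ P.1# → ∀ {g} → g P.≈ f P.* p → PL.Prime g
  ∣-prime {p} {f} (PL.mkPrime p≉0 p∤1 split) (u , uf≈1) {g} g≈fp = PL.mkPrime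
    (λ g≈0 → p≉0 (P.trans (P.sym ug≈p) (P.trans (P.*-congˡ {u} g≈0) (P.zeroʳ u))))
    (λ g∣1 → p∤1 (PL.∣-trans p∣g g∣1))
    (λ g∣xy → Sum.map (PL.∣-trans g∣p) (PL.∣-trans g∣p) (split (PL.∣-trans p∣g g∣xy)))
    where
    ug≈p : u P.* g P.≈ p
    ug≈p = begin
      u P.* g          ≈⟨ P.*-congˡ {u} g≈fp ⟩
      u P.* (f P.* p)  ≈⟨ P.*-assoc u f p ⟨
      u P.* f P.* p    ≈⟨ P.*-congʳ {p} uf≈1 ⟩
      P.1# P.* p       ≈⟨ P.*-identityˡ p ⟩
      p                ∎
    p∣g : p PL.∣ g
    p∣g = f , P.sym g≈fp
    g∣p : g PL.∣ p
    g∣p = u , ug≈p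

  irreducible⇒prime : ∀ {f} → PL.Irreducible f → PL.Prime f
  irreducible⇒prime {f} f-irreducible@(PL.mkIrred f∤1 split) with degree f
  -- From 0 ≈ 0 * 0 irreducibility would make 0, and with it f, a unit.
  ... | inj₁ f≈0 = contradiction
    (Sum.reduce (split {[]} {[]} f≈0))
    (λ 0∣1 → f∤1 (PL.∣-respˡ (P.sym f≈0) 0∣1))
  ... | inj₂ (suc D , hd) = PositiveDegree.positiveDegree-prime f-irreducible hd
  -- A nonzero constant: its first prime factor p is no unit, so the cofactor s is one, and f is
  -- prime along with p.
  ... | inj₂ (zero , f< , f₀≉0) with factored f₀≉0
  ...   | RL.unit f₀∣1 = contradiction
    (PL.∣-respˡ (P.sym (below-1 {f} f<)) (C-∣ f₀∣1)) f∤1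
  ...   | RL.prime {p = p} {s} p-prime f₀≈ps _ with P.trans (below-1 {f} f<) (P.trans (∷-cong f₀≈ps P.refl) (C-homo-* p s))
  ...     | f≈ps with split f≈ps
  ...       | inj₁ p∣1 = contradiction p∣1 (PL.Prime.p∤1 (C-prime p-prime))
  ...       | inj₂ s∣1 = ∣-prime (C-prime p-prime) s∣1 (P.trans f≈ps (P.*-comm (C p) (C s)))

-- Addition and total degree of tuples

infixl 6 _+ᵛ_
_+ᵛ_ : ∀ {k} → Vec ℕ k → Vec ℕ k → Vec ℕ k
_+ᵛ_ = zipWith ℕ._+_

lookup-injective : ∀ {a} {A : Set a} {k} {u v : Vec A k} → (∀ i → lookup u i ≡ lookup v i) → u ≡ v
lookup-injective {u = u} {v} eq =
  ≡.trans (≡.sym (Vec.tabulate∘lookup u)) (≡.trans (Vec.tabulate-cong eq) (Vec.tabulate∘lookup v))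

sum-+ᵛ : ∀ {k} (u v : Vec ℕ k) → Vec.sum (u +ᵛ v) ≡ Vec.sum u ℕ.+ Vec.sum v
sum-+ᵛ []      []      = ≡.refl
sum-+ᵛ (a ∷ u) (b ∷ v) = ≡.trans (≡.cong (a ℕ.+ b ℕ.+_) (sum-+ᵛ u v))
  (interchange a b (Vec.sum u) (Vec.sum v))
  where open CommutativeSemigroupProperties ℕ.+-commutativeSemigroup using (interchange)

sum≡0⇒≡𝟎 : ∀ {k} (u : Vec ℕ k) → Vec.sum u ≡ 0 → u ≡ 𝟎
sum≡0⇒≡𝟎 []      _    = ≡.refl
sum≡0⇒≡𝟎 (a ∷ u) eq = ≡.cong₂ _∷_ (ℕ.m+n≡0⇒m≡0 a eq) (sum≡0⇒≡𝟎 u (ℕ.m+n≡0⇒n≡0 a eq))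

sum-𝟎 : ∀ k → Vec.sum (𝟎 {k}) ≡ 0
sum-𝟎 zero    = ≡.refl
sum-𝟎 (suc k) = sum-𝟎 k

≢𝟎⇒0<sum : ∀ {k} {u : Vec ℕ k} → ¬ u ≡ 𝟎 → 0 < Vec.sum u
≢𝟎⇒0<sum u≢𝟎 = ℕ.n≢0⇒n>0 λ eq → u≢𝟎 (sum≡0⇒≡𝟎 _ eq)

-- Vector degrees over a finite field

module PolynomialsOver {q c ℓ} (F : FiniteField q c ℓ) where
  private module F = FiniteField F
  open Multivariate F
  open F using (0#; 1#)

  private
    module L k = RingLemmas (polynomials F.commutativeRing k)
    module X k = UnivariateLemmas (polynomials F.commutativeRing k)
  open Univariate using (at; coefficientwise)

  fieldElements : List F.Carrier
  fieldElements = List.map (Inverse.from F.size) (List.allFin q)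

  fieldElements-complete : ∀ a → Any (a F.≈_) fieldElements
  fieldElements-complete a = Any.map⁺ (lose (∈-allFin (Inverse.to F.size a))
    (F.sym (Inverse.inverseʳ F.size ≡.refl)))

  _≟F_ : ∀ a b → Dec (a F.≈ b)
  a ≟F b = Dec.map′ (λ eq → F.trans (F.sym (Inverse.inverseʳ F.size ≡.refl)) (Inverse.inverseʳ F.size eq))
    (Inverse.to-cong F.size) (Inverse.to F.size a Fin.≟ Inverse.to F.size b)

  _≈0? : ∀ {k} (f : Poly k) → Dec (Ring._≈_ k f (Ring.0# k))
  _≈0? {zero}  a = a ≟F 0#
  _≈0? {suc k} f = X.DecidableZero.[]? k (_≈0? {k}) f

  ≈? : ∀ k (f g : Poly k) → Dec (Ring._≈_ k f g)
  ≈? k f g = Dec.map′ (L.difference-≈ k)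
    (λ f≈g → Ring.trans k (Ring.+-congʳ k f≈g) (Ring.-‿inverseʳ k g))
    (_≈0? {k} (Ring._-_ k f g))

  integral : ∀ k {f g} → Ring._≈_ k (Ring._*_ k f g) (Ring.0# k) →
    Ring._≈_ k f (Ring.0# k) ⊎ Ring._≈_ k g (Ring.0# k)
  integral zero {a} {b} ab≈0 with a ≟F 0#
  ... | yes a≈0 = inj₁ a≈0
  ... | no  a≉0 with F.inverse a a≉0
  ...   | a⁻¹ , aa⁻¹≈1 = inj₂ (begin
    b                  ≈⟨ F.*-identityˡ b ⟨
    1# F.*F b          ≈⟨ F.*-congʳ (F.trans (F.sym aa⁻¹≈1) (F.*-comm a a⁻¹)) ⟩
    a⁻¹ F.*F a F.*F b  ≈⟨ F.*-assoc a⁻¹ a b ⟩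
    a⁻¹ F.*F (a F.*F b) ≈⟨ F.*-congˡ ab≈0 ⟩
    a⁻¹ F.*F 0#        ≈⟨ F.zeroʳ a⁻¹ ⟩
    0#                 ∎)
    where open SetoidReasoning F.setoid
  integral (suc k) = X.Domain.integral[X] k (integral k)

  private module D k = L.Domain k (integral k)

  1≉0 : ∀ k → ¬ Ring._≈_ k (Ring.1# k) (Ring.0# k)
  1≉0 zero    = F.1≉0
  1≉0 (suc k) 1≈0 = 1≉0 k (at 1≈0 0)

  constant-cong : ∀ k {a b} → a F.≈ b → Ring._≈_ k (constant k a) (constant k b)
  constant-cong zero    p = p
  constant-cong (suc k) p = X.∷-cong k (constant-cong k p) (Ring.refl (suc k) {[]})

  constant-0 : ∀ k → Ring._≈_ k (constant k 0#) (Ring.0# k)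
  constant-0 zero    = F.refl
  constant-0 (suc k) = Ring.trans (suc k) (X.∷-cong k (constant-0 k) (Ring.refl (suc k) {[]})) (X.0∷[]≈[] k)

  constant-1 : ∀ k → Ring._≈_ k (constant k 1#) (Ring.1# k)
  constant-1 zero    = F.refl
  constant-1 (suc k) = X.∷-cong k (constant-1 k) (Ring.refl (suc k) {[]})

  constant-* : ∀ k a b → Ring._≈_ k (constant k (a F.*F b)) (Ring._*_ k (constant k a) (constant k b))
  constant-* zero    a b = F.refl
  constant-* (suc k) a b = Ring.trans (suc k)
    (X.∷-cong k (constant-* k a b) (Ring.refl (suc k) {[]})) (X.C-homo-* k (constant k a) (constant k b))

  constant-unit : ∀ k {a} → a F.≉ 0# → L._∣_ k (constant k a) (Ring.1# k)
  constant-unit k {a} a≉0 with F.inverse a a≉0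
  ... | b , ab≈1 = constant k b , Ring.trans k (Ring.sym k (constant-* k b a))
    (Ring.trans k (constant-cong k (F.trans (F.*-comm b a) ab≈1)) (constant-1 k))

  coeff-cong : ∀ k {f g : Poly k} → Ring._≈_ k f g → ∀ e → coeff {k} f e F.≈ coeff {k} g e
  coeff-cong zero    f≈g []       = f≈g
  coeff-cong (suc k) f≈g (e ∷ es) = coeff-cong k (at f≈g e) es

  coeff-0 : ∀ k e → coeff {k} (Ring.0# k) e F.≈ 0#
  coeff-0 zero    []       = F.refl
  coeff-0 (suc k) (e ∷ es) = coeff-0 k es

  coeff≈0⇒≈0 : ∀ k {f : Poly k} → (∀ e → coeff {k} f e F.≈ 0#) → Ring._≈_ k f (Ring.0# k)
  coeff≈0⇒≈0 zero    p = p []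
  coeff≈0⇒≈0 (suc k) p = coefficientwise λ n → coeff≈0⇒≈0 k λ es → p (n ∷ es)

  -- Recursion on the variable: a bound in a later variable is a bound on every coefficient, and so
  -- falls under `everywhere-split`.
  DegreeBelow : ∀ {k} → Fin k → ℕ → Poly k → Set ℓ
  DegreeBelow {suc k} zero    n f = X.Below k n f
  DegreeBelow {suc k} (suc i) n f = X.Everywhere k (DegreeBelow i n) f

  degreeBelow-isAdditiveSubgroup : ∀ {k} (i : Fin k) n → L.IsAdditiveSubgroup k (DegreeBelow i n)
  degreeBelow-isAdditiveSubgroup {suc k} zero    n = X.below-isAdditiveSubgroup k n
  degreeBelow-isAdditiveSubgroup {suc k} (suc i) n =
    X.everywhere-isAdditiveSubgroup k (degreeBelow-isAdditiveSubgroup i n)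

  private module Below {k} (i : Fin k) n = L.IsAdditiveSubgroup k (degreeBelow-isAdditiveSubgroup i n)

  degreeBelow⇒coeff≈0 : ∀ {k} (i : Fin k) {n f} → DegreeBelow i n f →
    ∀ e → n ≤ lookup e i → coeff {k} f e F.≈ 0#
  degreeBelow⇒coeff≈0 {suc k} zero    f< (e ∷ es) n≤e = F.trans (coeff-cong k (f< e n≤e) es) (coeff-0 k es)
  degreeBelow⇒coeff≈0 {suc k} (suc i) f< (e ∷ es) n≤e = degreeBelow⇒coeff≈0 i (f< e) es n≤e

  coeff≈0⇒degreeBelow : ∀ {k} (i : Fin k) {n f} →
    (∀ e → n ≤ lookup e i → coeff {k} f e F.≈ 0#) → DegreeBelow i n f
  coeff≈0⇒degreeBelow {suc k} zero    p e n≤e = coeff≈0⇒≈0 k λ es → p (e ∷ es) n≤e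
  coeff≈0⇒degreeBelow {suc k} (suc i) p e     = coeff≈0⇒degreeBelow i λ es → p (e ∷ es)

  degreeBelow-mono : ∀ {k} (i : Fin k) {m n f} → m ≤ n → DegreeBelow i m f → DegreeBelow i n f
  degreeBelow-mono i m≤n f< = coeff≈0⇒degreeBelow i λ e n≤e → degreeBelow⇒coeff≈0 i f< e (ℕ.≤-trans m≤n n≤e)

  degreeBelow-0 : ∀ {k} (i : Fin k) {f} → DegreeBelow i 0 f → Ring._≈_ k f (Ring.0# k)
  degreeBelow-0 {k} i f< = coeff≈0⇒≈0 k λ e → degreeBelow⇒coeff≈0 i f< e z≤n

  degreeBelow-* : ∀ {k} (i : Fin k) {m n} f {g} →
    DegreeBelow i (suc m) f → DegreeBelow i n g → DegreeBelow i (m ℕ.+ n) (Ring._*_ k f g)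
  degreeBelow-* {suc k} zero    f f< g< = X.below-* k f f< g<
  degreeBelow-* {suc k} (suc i) {m} {n} f f< g< =
    X.everywhere-* k (degreeBelow-isAdditiveSubgroup i (m ℕ.+ n))
      (λ {a} → degreeBelow-* i a) f f< g<

  degreeBelow-*′ : ∀ {k} (i : Fin k) {m n} f {g} →
    DegreeBelow i m f → DegreeBelow i (suc n) g → DegreeBelow i (m ℕ.+ n) (Ring._*_ k f g)
  degreeBelow-*′ {k} i {m} {n} f {g} f< g< = Below.∈-resp-≈ i (m ℕ.+ n) (Ring.*-comm k g f)
    (≡.subst (λ d → DegreeBelow i d (Ring._*_ k g f)) (ℕ.+-comm n m) (degreeBelow-* i g g< f<))

  -- The degree of a product cannot fall short of the sum of the degrees: in the first variable the
  -- leading coefficients multiply to something nonzero, in a later one `everywhere-split` reduces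
  -- the claim to the coefficients.
  degreeBelow-split : ∀ {k} (i : Fin k) {m n} f g →
    DegreeBelow i (suc m) f → DegreeBelow i (suc n) g → DegreeBelow i (m ℕ.+ n) (Ring._*_ k f g) →
    DegreeBelow i m f ⊎ DegreeBelow i n g
  degreeBelow-split {suc k} zero {m} {n} f g f< g< fg< = Sum.map
    (X.below-improve k {f = f} f<) (X.below-improve k {f = g} g<)
    (integral k (Ring.trans k (Ring.sym k (X.leading-* k f f< g<)) (fg< (m ℕ.+ n) ℕ.≤-refl)))
  degreeBelow-split {suc k} (suc i) {m} {n} f g f< g< fg< =
    X.everywhere-split k (degreeBelow-isAdditiveSubgroup i (m ℕ.+ n))
      {P = DegreeBelow i m} {P̂ = DegreeBelow i (suc m)} {Q = DegreeBelow i n} {Q̂ = DegreeBelow i (suc n)}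
      (Below.0∈ i m) (Below.0∈ i n)
      (λ {a} → degreeBelow-*′ i a) (λ {a} → degreeBelow-* i a)
      (λ {a} {b} → degreeBelow-split i a b)
      f g f< g< fg<

  nonzeroCoeff : ∀ k (f : Poly k) → ¬ Ring._≈_ k f (Ring.0# k) → ∃ λ e → coeff {k} f e F.≉ 0#
  nonzeroCoeff zero    a f≉0 = [] , f≉0
  nonzeroCoeff (suc k) []      f≉0 = contradiction (Ring.refl (suc k)) f≉0
  nonzeroCoeff (suc k) (a ∷ f) f≉0 with _≈0? {k} a
  ... | no a≉0 with nonzeroCoeff k a a≉0
  ...   | es , p = (0 ∷ es) , p
  nonzeroCoeff (suc k) (a ∷ f) f≉0 | yes a≈0
    with nonzeroCoeff (suc k) f (λ f≈0 → f≉0 (Ring.trans (suc k) (X.∷-cong k a≈0 f≈0) (X.0∷[]≈[] k)))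
  ... | (e ∷ es) , p = (suc e ∷ es) , p

  -- `IsDegreeIn` asks for an exponent that attains the degree, which a bound alone does not
  -- provide.
  leadingExponent : ∀ {k} (i : Fin k) f → Ring._≈_ k f (Ring.0# k) ⊎
    ∃ λ e → coeff {k} f e F.≉ 0# × DegreeBelow i (suc (lookup e i)) f
  leadingExponent {suc k} zero f with X.DecidableZero.degree k (_≈0? {k}) f
  ... | inj₁ f≈0 = inj₁ f≈0
  ... | inj₂ (d , f< , f_d≉0) with nonzeroCoeff k _ f_d≉0
  ...   | es , p = inj₂ (d ∷ es , p , f<)
  leadingExponent {suc k} (suc i) [] = inj₁ (Ring.refl (suc k))
  leadingExponent {suc k} (suc i) (a ∷ f) with leadingExponent i a | leadingExponent (suc i) f
  ... | inj₁ a≈0 | inj₁ f≈0 = inj₁ (Ring.trans (suc k) (X.∷-cong k a≈0 f≈0) (X.0∷[]≈[] k))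
  ... | inj₁ a≈0 | inj₂ (e ∷ es , p , f<) = inj₂ (suc e ∷ es , p ,
    λ { zero → Below.∈-resp-≈ i _ (Ring.sym k a≈0) (Below.0∈ i _) ; (suc j) → f< j })
  ... | inj₂ (es , p , a<) | inj₁ f≈0 = inj₂ (0 ∷ es , p ,
    λ { zero → a< ; (suc j) → Below.∈-resp-≈ i _ (Ring.sym k (at f≈0 j)) (Below.0∈ i _) })
  ... | inj₂ (es , p , a<) | inj₂ (e′ ∷ es′ , p′ , f<) with ℕ.≤-total (lookup es i) (lookup es′ i)
  ...   | inj₁ ≤ = inj₂ (suc e′ ∷ es′ , p′ , λ { zero → degreeBelow-mono i (s≤s ≤) a< ; (suc j) → f< j })
  ...   | inj₂ ≥ = inj₂ (0 ∷ es , p , λ { zero → a< ; (suc j) → degreeBelow-mono i (s≤s ≥) (f< j) })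

  isDegreeIn⇒below : ∀ {k} (i : Fin k) {f d} → IsDegreeIn i f d → DegreeBelow i (suc d) f
  isDegreeIn⇒below {k} i {f} (_ , ≤d) = coeff≈0⇒degreeBelow i λ e d<e →
    decidable-stable (coeff {k} f e ≟F 0#) λ ≉0 → ℕ.<⇒≱ d<e (≤d e ≉0)

  isDegreeIn⇒≮ : ∀ {k} (i : Fin k) {f d} → IsDegreeIn i f d → ¬ DegreeBelow i d f
  isDegreeIn⇒≮ i ((e , ≡.refl , ≉0) , _) f< = ≉0 (degreeBelow⇒coeff≈0 i f< e ℕ.≤-refl)

  below⇒isDegreeIn : ∀ {k} (i : Fin k) {f d} →
    DegreeBelow i (suc d) f → ¬ DegreeBelow i d f → IsDegreeIn i f d
  below⇒isDegreeIn {k} i {f} {d} f<1+d f≮d with leadingExponent i f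
  ... | inj₁ f≈0 = contradiction (Below.∈-resp-≈ i d (Ring.sym k f≈0) (Below.0∈ i d)) f≮d
  ... | inj₂ (e , ≉0 , f<) = (e , ℕ.≤-antisym (≤d e ≉0) d≤e , ≉0) , ≤d
    where
    ≤d : ∀ e → coeff f e F.≉ 0# → lookup e i ≤ d
    ≤d e ≉0 = ℕ.≮⇒≥ λ d<e → ≉0 (degreeBelow⇒coeff≈0 i f<1+d e d<e)
    d≤e : d ≤ lookup e i
    d≤e = ℕ.≮⇒≥ λ e<d → f≮d (degreeBelow-mono i e<d f<)

  isDegreeIn-unique : ∀ {k} (i : Fin k) {f m n} → IsDegreeIn i f m → IsDegreeIn i f n → m ≡ n
  isDegreeIn-unique i ((e , ≡.refl , ≉0) , ≤m) ((e′ , ≡.refl , ≉0′) , ≤n) = ℕ.≤-antisym (≤n e ≉0) (≤m e′ ≉0′)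

  isDegreeIn-resp-≈ : ∀ {k} (i : Fin k) {f g d} → Ring._≈_ k f g → IsDegreeIn i f d → IsDegreeIn i g d
  isDegreeIn-resp-≈ {k} i f≈g ((e , eq , ≉0) , ≤d) =
    (e , eq , λ ≈0 → ≉0 (F.trans (coeff-cong k f≈g e) ≈0)) ,
    λ e ≉0 → ≤d e λ ≈0 → ≉0 (F.trans (F.sym (coeff-cong k f≈g e)) ≈0)

  isDegreeIn-* : ∀ {k} (i : Fin k) {m n} f g → IsDegreeIn i f m → IsDegreeIn i g n →
    IsDegreeIn i (Ring._*_ k f g) (m ℕ.+ n)
  isDegreeIn-* {k} i {m} {n} f g fₘ gₙ = below⇒isDegreeIn i
    (≡.subst (λ d → DegreeBelow i d (Ring._*_ k f g)) (ℕ.+-suc m n)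
      (degreeBelow-* i f (isDegreeIn⇒below i fₘ) (isDegreeIn⇒below i gₙ)))
    λ fg< → [ isDegreeIn⇒≮ i fₘ , isDegreeIn⇒≮ i gₙ ]′
      (degreeBelow-split i f g (isDegreeIn⇒below i fₘ) (isDegreeIn⇒below i gₙ) fg<)

  -- `HasDeg` wrapped in a record, so that f and m can be inferred from it.
  record VectorDegree k (f : Poly k) (m : Vec ℕ k) : Set ℓ where
    constructor vectorDegree
    field hasDeg : HasDeg f m

    nonzero : ¬ Ring._≈_ k f (Ring.0# k)
    nonzero = proj₁ hasDeg

    degreeIn : ∀ i → IsDegreeIn i f (lookup m i)
    degreeIn = proj₂ hasDeg

  open VectorDegree public

  deg-unique : ∀ {k} {f : Poly k} {m n} → VectorDegree k f m → VectorDegree k f n → m ≡ n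
  deg-unique {f = f} fₘ fₙ = lookup-injective λ i → isDegreeIn-unique i {f} (degreeIn fₘ i) (degreeIn fₙ i)

  deg-resp-≈ : ∀ {k} {f g : Poly k} {m} → Ring._≈_ k f g → VectorDegree k f m → VectorDegree k g m
  deg-resp-≈ {k} {f} {g} f≈g fₘ = vectorDegree ((λ g≈0 → nonzero fₘ (Ring.trans k f≈g g≈0)) ,
    λ i → isDegreeIn-resp-≈ i {f} {g} f≈g (degreeIn fₘ i))

  deg-* : ∀ {k} {f g : Poly k} {m n} → VectorDegree k f m → VectorDegree k g n →
    VectorDegree k (Ring._*_ k f g) (m +ᵛ n)
  deg-* {k} {f} {g} {m} {n} fₘ gₙ = vectorDegree (D.*-≉0 k (nonzero fₘ) (nonzero gₙ) , λ i →
    ≡.subst (IsDegreeIn i (Ring._*_ k f g)) (≡.sym (Vec.lookup-zipWith ℕ._+_ i m n))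
      (isDegreeIn-* i f g (degreeIn fₘ i) (degreeIn gₙ i)))

  deg : ∀ {k} {f : Poly k} → ¬ Ring._≈_ k f (Ring.0# k) → ∃ (VectorDegree k f)
  deg {k} {f} f≉0 = Vec.tabulate (λ i → proj₁ (d i)) , vectorDegree (f≉0 , λ i →
    ≡.subst (IsDegreeIn i f) (≡.sym (Vec.lookup∘tabulate (λ i → proj₁ (d i)) i)) (proj₂ (d i)))
    where
    d : ∀ i → ∃ (IsDegreeIn i f)
    d i with leadingExponent i f
    ... | inj₁ f≈0 = contradiction f≈0 f≉0
    ... | inj₂ (e , ≉0 , f<) = lookup e i , below⇒isDegreeIn i {f} f<
      λ f≮ → ≉0 (degreeBelow⇒coeff≈0 i {f = f} f≮ e ℕ.≤-refl)

  deg? : ∀ {k} (f : Poly k) m → Dec (VectorDegree k f m)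
  deg? {k} f m with _≈0? {k} f
  ... | yes f≈0 = no λ fₘ → nonzero fₘ f≈0
  ... | no f≉0 with deg {k} {f} f≉0
  ...   | n , fₙ = Dec.map′ (λ { ≡.refl → fₙ }) (λ fₘ → deg-unique fₙ fₘ) (Vec.≡-dec ℕ._≟_ n m)

  degreeBelow-1⇒deg-𝟎 : ∀ {k} {f : Poly k} → ¬ Ring._≈_ k f (Ring.0# k) →
    (∀ (i : Fin k) → DegreeBelow i 1 f) → VectorDegree k f 𝟎
  degreeBelow-1⇒deg-𝟎 {k} {f} f≉0 f<1 = vectorDegree (f≉0 , λ i →
    ≡.subst (IsDegreeIn i f) (≡.sym (Vec.lookup-replicate i 0))
      (below⇒isDegreeIn i {f} (f<1 i) λ f<0 → f≉0 (degreeBelow-0 i {f} f<0)))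

  1-degreeBelow-1 : ∀ {k} (i : Fin k) → DegreeBelow i 1 (Ring.1# k)
  1-degreeBelow-1 {suc k} zero    (suc j) _ = Ring.refl k
  1-degreeBelow-1 {suc k} (suc i) zero    = 1-degreeBelow-1 i
  1-degreeBelow-1 {suc k} (suc i) (suc j) = Below.0∈ i 1

  deg-1 : ∀ k → VectorDegree k (Ring.1# k) (𝟎 {k})
  deg-1 k = degreeBelow-1⇒deg-𝟎 (1≉0 k) 1-degreeBelow-1

  degreeBelow-1⇒constant : ∀ k {f : Poly k} → (∀ (i : Fin k) → DegreeBelow i 1 f) →
    Ring._≈_ k f (constant k (coeff {k} f 𝟎))
  degreeBelow-1⇒constant zero    _   = F.refl
  degreeBelow-1⇒constant (suc k) {f} f<1 = Ring.trans (suc k) (X.below-1 k {f} (f<1 zero))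
    (X.∷-cong k (degreeBelow-1⇒constant k λ i → f<1 (suc i) 0) (Ring.refl (suc k) {[]}))

  deg-𝟎⇒constant : ∀ {k} {f : Poly k} → VectorDegree k f 𝟎 → ∃ λ a → a F.≉ 0# × Ring._≈_ k f (constant k a)
  deg-𝟎⇒constant {k} {f} f₀ = coeff {k} f 𝟎 ,
    (λ a≈0 → nonzero f₀ (Ring.trans k f≈a (Ring.trans k (constant-cong k a≈0) (constant-0 k)))) , f≈a
    where
    f≈a : Ring._≈_ k f (constant k (coeff {k} f 𝟎))
    f≈a = degreeBelow-1⇒constant k λ i → isDegreeIn⇒below i {f}
      (≡.subst (IsDegreeIn i f) (Vec.lookup-replicate i 0) (degreeIn f₀ i))

  deg-𝟎⇒unit : ∀ {k} {f : Poly k} → VectorDegree k f 𝟎 → L._∣_ k f (Ring.1# k)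
  deg-𝟎⇒unit {k} f₀ with deg-𝟎⇒constant f₀
  ... | a , a≉0 , f≈a = L.∣-respˡ k (Ring.sym k f≈a) (constant-unit k a≉0)

  deg-factors : ∀ {k} {f g h : Poly k} {m} → Ring._≈_ k (Ring._*_ k g h) f → VectorDegree k f m →
    ∃₂ λ a b → VectorDegree k g a × VectorDegree k h b × a +ᵛ b ≡ m
  deg-factors {k} {f} {g} {h} gh≈f fₘ
    with deg {k} {g} (L.*-≉0ˡ k gh≉0) | deg {k} {h} (L.*-≉0ʳ k gh≉0)
    where
    gh≉0 : ¬ Ring._≈_ k (Ring._*_ k g h) (Ring.0# k)
    gh≉0 gh≈0 = nonzero fₘ (Ring.trans k (Ring.sym k gh≈f) gh≈0)
  ... | a , gₐ | b , h_b = a , b , gₐ , h_b ,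
    deg-unique (deg-* gₐ h_b) (deg-resp-≈ (Ring.sym k gh≈f) fₘ)

  unit⇒deg-𝟎 : ∀ {k} {f : Poly k} → L._∣_ k f (Ring.1# k) → VectorDegree k f 𝟎
  unit⇒deg-𝟎 {k} {f} (g , gf≈1) with deg-factors {k} {g = g} {f} gf≈1 (deg-1 k)
  ... | m , n , _ , fₙ , m+n≡0 = ≡.subst (VectorDegree k f) (sum≡0⇒≡𝟎 n (ℕ.m+n≡0⇒n≡0 (Vec.sum m)
    (≡.trans (≡.sym (sum-+ᵛ m n)) (≡.trans (≡.cong Vec.sum m+n≡0) (sum-𝟎 k))))) fₙ

  unit? : ∀ k (f : Poly k) → Dec (L._∣_ k f (Ring.1# k))
  unit? k f = Dec.map′ (deg-𝟎⇒unit {k}) (unit⇒deg-𝟎 {k}) (deg? f 𝟎)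

  tuples : ∀ {a} {A : Set a} → ℕ → List A → List (List A)
  tuples zero    xs = [] ∷ []
  tuples (suc n) xs = cartesianProductWith _∷_ xs (tuples n xs)

  -- The finite search space: coefficient lists of full length n + 1 in each variable, with trailing
  -- zeros, so that polynomials of smaller degree are included.
  polys : ∀ {k} → Vec ℕ k → List (Poly k)
  polys []      = fieldElements
  polys (n ∷ m) = tuples (suc n) (polys m)

  tuples-complete : ∀ {k} n {xs : List (Poly k)} (f : Poly (suc k)) → X.Below k n f →
    X.Everywhere k (λ a → Any (Ring._≈_ k a) xs) f → Any (Ring._≈_ k (Ring.0# k)) xs →
    Any (Ring._≈_ (suc k) f) (tuples n xs)
  tuples-complete {k} zero f f< _ _ = here (X.below-0 k {f} f<)
  -- A list that ends early is padded with zero coefficients, hence the assumption that `xs`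
  -- contains 0.
  tuples-complete {k} (suc n) {xs} [] _ _ 0∈ = Any.cartesianProductWith⁺ _∷_ {xs = xs} {tuples n xs}
    (λ 0≈a []≈g → Ring.trans (suc k) (Ring.sym (suc k) (X.0∷[]≈[] k)) (X.∷-cong k 0≈a []≈g))
    0∈ (tuples-complete {k} n {xs} [] (λ _ _ → Ring.refl k) (λ _ → 0∈) 0∈)
  tuples-complete {k} (suc n) (a ∷ f) f< f∈ 0∈ = Any.cartesianProductWith⁺ _∷_ (X.∷-cong k) (f∈ 0)
    (tuples-complete {k} n f (X.below-tail k {f = f} f<) (λ j → f∈ (suc j)) 0∈)

  polys-complete : ∀ {k} (m : Vec ℕ k) {f} → (∀ i → DegreeBelow i (suc (lookup m i)) f) →
    Any (Ring._≈_ k f) (polys m)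
  polys-complete []      _  = fieldElements-complete _
  polys-complete {suc k} (n ∷ m) {f} f< = tuples-complete {k} (suc n) f (f< zero)
    (λ j → polys-complete m λ i → f< (suc i) j)
    (polys-complete m λ i → Below.0∈ i (suc (lookup m i)))

  deg⇒∈polys : ∀ {k} {f : Poly k} {m n} → VectorDegree k f n → (∀ i → lookup n i ≤ lookup m i) →
    Any (Ring._≈_ k f) (polys m)
  deg⇒∈polys {f = f} {m} fₙ n≤m = polys-complete m λ i →
    degreeBelow-mono i {f = f} (s≤s (n≤m i)) (isDegreeIn⇒below i {f} (degreeIn fₙ i))

lookup-≤ˡ : ∀ {k} (u v : Vec ℕ k) {w} → u +ᵛ v ≡ w → ∀ i → lookup u i ≤ lookup w i
lookup-≤ˡ u v ≡.refl i = ℕ.≤-trans (ℕ.m≤m+n _ _) (ℕ.≤-reflexive (≡.sym (Vec.lookup-zipWith ℕ._+_ i u v)))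

lookup-≤ʳ : ∀ {k} (u v : Vec ℕ k) {w} → u +ᵛ v ≡ w → ∀ i → lookup v i ≤ lookup w i
lookup-≤ʳ u v ≡.refl i = ℕ.≤-trans (ℕ.m≤n+m _ _) (ℕ.≤-reflexive (≡.sym (Vec.lookup-zipWith ℕ._+_ i u v)))

sum-<ˡ : ∀ {k} {u v w : Vec ℕ k} → ¬ v ≡ 𝟎 → u +ᵛ v ≡ w → Vec.sum u < Vec.sum w
sum-<ˡ {u = u} {v} v≢𝟎 ≡.refl =
  ≡.subst (Vec.sum u <_) (≡.sym (sum-+ᵛ u v)) (ℕ.m<m+n (Vec.sum u) (≢𝟎⇒0<sum v≢𝟎))

-- Unique factorization over a finite field

module UniqueFactorization {q c ℓ} (F : FiniteField q c ℓ) where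
  private module F = FiniteField F
  open Multivariate F
  open PolynomialsOver F
  open F using (0#; 1#)

  private
    module L k = RingLemmas (polynomials F.commutativeRing k)
    module D k = L.Domain k (integral k)
    module A k = Setoid (associatedSetoid k)

  nonunit⇒deg≢𝟎 : ∀ {k} {f : Poly k} {m} → VectorDegree k f m → ¬ L._∣_ k f (Ring.1# k) → ¬ m ≡ 𝟎
  nonunit⇒deg≢𝟎 {k} {f} fₘ f∤1 ≡.refl = f∤1 (deg-𝟎⇒unit fₘ)

  IsReducible : ∀ k → Poly k → Set _
  IsReducible k f = ∃₂ λ g h → Ring._≈_ k (Ring._*_ k g h) f ×
    ¬ L._∣_ k g (Ring.1# k) × ¬ L._∣_ k h (Ring.1# k)

  -- All pairs of candidates from `polys m` are tried. This is exhaustive because the degrees of two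
  -- factors of f add up to m.
  irreducible⊎reducible : ∀ k {f : Poly k} {m} → VectorDegree k f m → ¬ L._∣_ k f (Ring.1# k) →
    IsIrreducible k f ⊎ IsReducible k f
  irreducible⊎reducible k {f} {m} fₘ f∤1 with Any.any? (λ g → Any.any? (λ h →
    ≈? k (Ring._*_ k g h) f ×-dec ¬? (unit? k g) ×-dec ¬? (unit? k h)) (polys m)) (polys m)
  ... | yes found with Any.satisfied found
  ...   | g , found-h with Any.satisfied found-h
  ...     | h , reducible = inj₂ (g , h , reducible)
  irreducible⊎reducible k {f} {m} fₘ f∤1 | no none = inj₁ (L.mkIrred {k} f∤1 split)
    where
    split : ∀ {g h} → Ring._≈_ k f (Ring._*_ k g h) → L._∣_ k g (Ring.1# k) ⊎ L._∣_ k h (Ring.1# k)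
    split {g} {h} f≈gh with unit? k g | unit? k h
    ... | yes g∣1 | _       = inj₁ g∣1
    ... | no  _   | yes h∣1 = inj₂ h∣1
    ... | no  g∤1 | no  h∤1 with deg-factors {k} {f} {g} {h} (Ring.sym k f≈gh) fₘ
    ...   | a , b , gₐ , h_b , a+b≡m = contradiction
      (Any.map (λ g≈g′ → Any.map (λ h≈h′ →
          Ring.sym k (Ring.trans k f≈gh (Ring.*-cong k g≈g′ h≈h′)) ,
          (λ g′∣1 → g∤1 (L.∣-respˡ k (Ring.sym k g≈g′) g′∣1)) ,
          (λ h′∣1 → h∤1 (L.∣-respˡ k (Ring.sym k h≈h′) h′∣1)))
        (deg⇒∈polys {m = m} h_b (lookup-≤ʳ a b a+b≡m))) (deg⇒∈polys {m = m} gₐ (lookup-≤ˡ a b a+b≡m))) none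

  irreducible? : ∀ k {f : Poly k} {m} → VectorDegree k f m → Dec (IsIrreducible k f)
  irreducible? k {f} fₘ with unit? k f
  ... | yes f∣1 = no λ f-irr → L.Irreducible.p∤1 {k} f-irr f∣1
  ... | no  f∤1 with irreducible⊎reducible k fₘ f∤1
  ...   | inj₁ f-irr = yes f-irr
  ...   | inj₂ (g , h , gh≈f , g∤1 , h∤1) = no λ f-irr →
    [ g∤1 , h∤1 ]′ (L.Irreducible.split-∣1 {k} f-irr (Ring.sym k gh≈f))

  irreducibleDivisor : ∀ k {f : Poly k} {m} → VectorDegree k f m → ¬ L._∣_ k f (Ring.1# k) →
    ∃ λ p → IsIrreducible k p × L._∣_ k p f
  irreducibleDivisor k fₘ = go _ fₘ ℕ.≤-refl
    where
    go : ∀ n {f : Poly k} {m} → VectorDegree k f m → Vec.sum m ≤ n → ¬ L._∣_ k f (Ring.1# k) →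
      ∃ λ p → IsIrreducible k p × L._∣_ k p f
    go n {f} fₘ m≤n f∤1 with irreducible⊎reducible k fₘ f∤1
    ... | inj₁ f-irr = f , f-irr , L.∣-refl k
    ... | inj₂ (g , h , gh≈f , g∤1 , h∤1) with deg-factors {k} {f} {g} {h} gh≈f fₘ
    -- The cofactor h is no unit, so its degree is not `𝟎` and the total degree of g is smaller; n
    -- bounds the total degree.
    ...   | a , b , gₐ , h_b , a+b≡m with n | ℕ.≤-trans (sum-<ˡ (nonunit⇒deg≢𝟎 h_b h∤1) a+b≡m) m≤n
    ...     | suc n′ | s≤s a≤n′ with go n′ gₐ a≤n′ g∤1
    ...       | p , p-irr , p∣g = p , p-irr , L.∣-trans k p∣g (h , Ring.trans k (Ring.*-comm k h g) gh≈f)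

  -- Primality for k variables is an argument, because the induction below passes its own case k
  -- here in order to reach k + 1.
  factored : ∀ k → (∀ {p} → IsIrreducible k p → L.Prime k p) →
    ∀ {f : Poly k} → ¬ Ring._≈_ k f (Ring.0# k) → L.Factored k f
  factored k irreducible⇒prime f≉0 = go _ (proj₂ (deg {k} f≉0)) ℕ.≤-refl
    where
    go : ∀ n {f : Poly k} {m} → VectorDegree k f m → Vec.sum m ≤ n → L.Factored k f
    go n {f} fₘ m≤n with unit? k f
    ... | yes f∣1 = L.unit {k} f∣1
    ... | no  f∤1 with irreducibleDivisor k fₘ f∤1
    ...   | p , p-irr , (g , gp≈f) with deg-factors {k} {f} {g} {p} gp≈f fₘ
    ...     | a , b , gₐ , p_b , a+b≡m
      with n | ℕ.≤-trans (sum-<ˡ (nonunit⇒deg≢𝟎 p_b (L.Irreducible.p∤1 {k} p-irr)) a+b≡m) m≤n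
    ...       | suc n′ | s≤s a≤n′ = L.prime {k} (irreducible⇒prime p-irr)
      (Ring.trans k (Ring.sym k gp≈f) (Ring.*-comm k g p)) (go n′ gₐ a≤n′)

  irreducible⇒≉0 : ∀ k {f : Poly k} → IsIrreducible k f → ¬ Ring._≈_ k f (Ring.0# k)
  irreducible⇒≉0 k = L.Irreducible⇒≉0 k λ 0≈1 → 1≉0 k (Ring.sym k 0≈1)

  -- In no variables the claim is vacuous, since every nonzero field element is a unit.
  irreducible⇒prime : ∀ k {f : Poly k} → IsIrreducible k f → L.Prime k f
  irreducible⇒prime zero    f-irr = contradiction (constant-unit zero (irreducible⇒≉0 zero f-irr))
    (L.Irreducible.p∤1 {zero} f-irr)
  irreducible⇒prime (suc k) = GaussLemma.irreducible⇒prime (polynomials F.commutativeRing k)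
    (_≈0? {k}) (integral k) (factored k (irreducible⇒prime k))

  associated⇒∣ : ∀ k {f g : Poly k} → Associated k f g → L._∣_ k g f
  associated⇒∣ k (a , _ , f≈ag) = constant k a , Ring.sym k f≈ag

  unit-*⇒associated : ∀ k {u f g : Poly k} → L._∣_ k u (Ring.1# k) → Ring._≈_ k (Ring._*_ k u g) f →
    Associated k f g
  unit-*⇒associated k u∣1 ug≈f with deg-𝟎⇒constant (unit⇒deg-𝟎 {k} u∣1)
  ... | a , a≉0 , u≈a = a , a≉0 , Ring.trans k (Ring.sym k ug≈f) (Ring.*-congʳ k u≈a)

  ≈⇒associated : ∀ k {f g : Poly k} → Ring._≈_ k f g → Associated k f g
  ≈⇒associated k {f} {g} f≈g = unit-*⇒associated k (L.∣-refl k) (Ring.trans k (Ring.*-identityˡ k g) (Ring.sym k f≈g))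

  associated-* : ∀ k (p : Poly k) {f g} → Associated k f g →
    Associated k (Ring._*_ k p f) (Ring._*_ k p g)
  associated-* k p {f} {g} (a , a≉0 , f≈ag) = a , a≉0 ,
    Ring.trans k (Ring.*-congˡ k f≈ag) (L.x∙yz≈y∙xz k p (constant k a) g)

  associated-cancel : ∀ k {p : Poly k} {f g} → ¬ Ring._≈_ k p (Ring.0# k) →
    Associated k (Ring._*_ k p f) (Ring._*_ k p g) → Associated k f g
  associated-cancel k {p} {f} {g} p≉0 (a , a≉0 , pf≈apg) = a , a≉0 ,
    D.*-cancelˡ k p≉0 (Ring.trans k pf≈apg (L.x∙yz≈y∙xz k (constant k a) p g))

  deg-resp-associated : ∀ {k} {f g : Poly k} {m} → Associated k f g → VectorDegree k f m → VectorDegree k g m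
  deg-resp-associated {k} {f} {g} {m} f~g fₘ with A.sym k f~g
  ... | a , a≉0 , g≈af with unit⇒deg-𝟎 {k} (constant-unit k a≉0)
  ...   | a₀ = deg-resp-≈ (Ring.sym k g≈af) (≡.subst (VectorDegree k _) (Vec.zipWith-identityˡ ℕ.+-identityˡ m) (deg-* a₀ fₘ))

  irreducible-resp-associated : ∀ k {f g : Poly k} → Associated k f g → IsIrreducible k f → IsIrreducible k g
  irreducible-resp-associated k {f} {g} f~g@(a , a≉0 , f≈ag) (L.mkIrred f∤1 split) = L.mkIrred {k}
    (λ g∣1 → f∤1 (L.∣-trans k (associated⇒∣ k (A.sym k f~g)) g∣1))
    (λ {x} {y} g≈xy → Sum.map₁ (L.∣-trans k (constant k a , Ring.refl k))
      (split {Ring._*_ k (constant k a) x} {y}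
        (Ring.trans k f≈ag (Ring.trans k (Ring.*-congˡ k g≈xy) (Ring.sym k (Ring.*-assoc k _ x y))))))

  irreducible-∣⇒associated : ∀ k {p r : Poly k} → IsIrreducible k p → IsIrreducible k r → L._∣_ k r p →
    Associated k p r
  irreducible-∣⇒associated k p-irr r-irr (u , ur≈p) with L.Irreducible.split-∣1 {k} p-irr (Ring.sym k ur≈p)
  ... | inj₁ u∣1 = unit-*⇒associated k u∣1 ur≈p
  ... | inj₂ r∣1 = contradiction r∣1 (L.Irreducible.p∤1 {k} r-irr)

  associated? : ∀ k (f g : Poly k) → Dec (Associated k f g)
  associated? k f g = Dec.map′ Any.satisfied
    (λ (a , a≉0 , f≈ag) → Any.map (λ a≈b → (λ b≈0 → a≉0 (F.trans a≈b b≈0)) ,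
      Ring.trans k f≈ag (Ring.*-congʳ k (constant-cong k a≈b))) (fieldElements-complete a))
    (Any.any? (λ a → ¬? (a ≟F 0#) ×-dec ≈? k f (Ring._*_ k (constant k a) g)) fieldElements)

  divides? : ∀ k (p : Poly k) {f m} → VectorDegree k f m → Dec (L._∣_ k p f)
  divides? k p {f} {m} fₘ = Dec.map′ (λ found → let (g , gp≈f) = Any.satisfied found in g , gp≈f)
    (λ (g , gp≈f) → let (a , b , gₐ , _ , a+b≡m) = deg-factors {k} {f} {g} {p} gp≈f fₘ in
      Any.map (λ g≈g′ → Ring.trans k (Ring.*-congʳ k (Ring.sym k g≈g′)) gp≈f)
        (deg⇒∈polys {m = m} gₐ (lookup-≤ˡ a b a+b≡m)))
    (Any.any? (λ g → ≈? k (Ring._*_ k g p) f) (polys m))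

open import Data.Nat.Base using (_+_; _*_; _∸_)
open import Data.List.Base using (_++_; length; map; foldr; applyUpTo; upTo; filter; concatMap; tabulate)
open import Data.Vec.Base using (fromList; toList)
open import Relation.Binary.PropositionalEquality using (refl; cong; cong₂; sym; trans; module ≡-Reasoning)

-- Sums over families of multiplicities

+ᵛ-assoc : ∀ {k} (u v w : Vec ℕ k) → (u +ᵛ v) +ᵛ w ≡ u +ᵛ (v +ᵛ w)
+ᵛ-assoc = Vec.zipWith-assoc ℕ.+-assoc

+ᵛ-identityˡ : ∀ {k} (u : Vec ℕ k) → 𝟎 +ᵛ u ≡ u
+ᵛ-identityˡ = Vec.zipWith-identityˡ ℕ.+-identityˡ

+ᵛ-identityʳ : ∀ {k} (u : Vec ℕ k) → u +ᵛ 𝟎 ≡ u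
+ᵛ-identityʳ = Vec.zipWith-identityʳ ℕ.+-identityʳ

infixr 7 _∙ᵛ_
_∙ᵛ_ : ∀ {k} → ℕ → Vec ℕ k → Vec ℕ k
a ∙ᵛ u = Vec.map (a *_) u

0∙ᵛ : ∀ {k} (u : Vec ℕ k) → 0 ∙ᵛ u ≡ 𝟎
0∙ᵛ u = Vec.map-const u 0

suc∙ᵛ : ∀ {k} a (u : Vec ℕ k) → suc a ∙ᵛ u ≡ u +ᵛ a ∙ᵛ u
suc∙ᵛ a []      = refl
suc∙ᵛ a (x ∷ u) = cong (x + a * x ∷_) (suc∙ᵛ a u)

sum-∙ᵛ : ∀ {k} a (u : Vec ℕ k) → Vec.sum (a ∙ᵛ u) ≡ a * Vec.sum u
sum-∙ᵛ a []      = sym (ℕ.*-zeroʳ a)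
sum-∙ᵛ a (x ∷ u) = trans (cong (a * x +_) (sum-∙ᵛ a u)) (sym (ℕ.*-distribˡ-+ a x (Vec.sum u)))

-- One copy of d plus s further ones have total degree at least s + 1. With s the total degree of m,
-- this kills the boundary term in Pascal's rule.
<-sum-∙ᵛ : ∀ {k} s (w : Vec ℕ k) {d : Vec ℕ k} → 0 < Vec.sum d → s < Vec.sum ((w +ᵛ d) +ᵛ s ∙ᵛ d)
<-sum-∙ᵛ s w {d} 0<d = begin-strict
  s                                       ≡⟨ ℕ.*-identityʳ s ⟨
  s * 1                                   ≤⟨ ℕ.*-monoʳ-≤ s 0<d ⟩
  s * Vec.sum d                           <⟨ ℕ.m<n+m _ 0<d ⟩
  Vec.sum d + s * Vec.sum d               ≤⟨ ℕ.m≤n+m _ (Vec.sum w) ⟩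
  Vec.sum w + (Vec.sum d + s * Vec.sum d) ≡⟨ ℕ.+-assoc (Vec.sum w) _ _ ⟨
  Vec.sum w + Vec.sum d + s * Vec.sum d   ≡⟨ cong₂ _+_ (sum-+ᵛ w d) (sum-∙ᵛ s d) ⟨
  Vec.sum (w +ᵛ d) + Vec.sum (s ∙ᵛ d)     ≡⟨ sum-+ᵛ (w +ᵛ d) (s ∙ᵛ d) ⟨
  Vec.sum ((w +ᵛ d) +ᵛ s ∙ᵛ d)            ∎
  where open ℕ.≤-Reasoning

multisets-empty : ∀ a → multisets 0 (suc a) ≡ 0
multisets-empty a = k>n⇒nCk≡0 (ℕ.n<1+n a)

-- A multiset avoids a chosen element or contains it, and then one copy can be removed.
multisets-pascal : ∀ n a → multisets (suc n) (suc a) ≡ multisets n (suc a) + multisets (suc n) a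
multisets-pascal n a = begin
  (n + suc a) C suc a                 ≡⟨ cong (_C suc a) (ℕ.+-suc n a) ⟩
  suc (n + a) C suc a                 ≡⟨ nCk+nC[k+1]≡[n+1]C[k+1] (n + a) a ⟨
  (n + a) C a + (n + a) C suc a       ≡⟨ ℕ.+-comm ((n + a) C a) _ ⟩
  (n + a) C suc a + (n + a) C a       ≡⟨ cong (λ t → (t ∸ 1) C suc a + (n + a) C a) (ℕ.+-suc n a) ⟨
  multisets n (suc a) + multisets (suc n) a ∎
  where open ≡-Reasoning

∑< : ℕ → (ℕ → ℕ) → ℕ
∑< n f = sum (applyUpTo f n)

∑<-cong : ∀ n {f g : ℕ → ℕ} → (∀ a → f a ≡ g a) → ∑< n f ≡ ∑< n g
∑<-cong zero    f≗g = refl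
∑<-cong (suc n) f≗g = cong₂ _+_ (f≗g 0) (∑<-cong n (f≗g ∘ suc))

∑<-0 : ∀ n {f : ℕ → ℕ} → (∀ a → f a ≡ 0) → ∑< n f ≡ 0
∑<-0 zero    f≗0 = refl
∑<-0 (suc n) f≗0 = cong₂ _+_ (f≗0 0) (∑<-0 n (f≗0 ∘ suc))

∑<-+ : ∀ n (f g : ℕ → ℕ) → ∑< n (λ a → f a + g a) ≡ ∑< n f + ∑< n g
∑<-+ zero    f g = refl
∑<-+ (suc n) f g = trans (cong (f 0 + g 0 +_) (∑<-+ n (f ∘ suc) (g ∘ suc)))
  (CommutativeSemigroupProperties.interchange ℕ.+-commutativeSemigroup (f 0) (g 0) (∑< n (f ∘ suc)) (∑< n (g ∘ suc)))

∑<-last : ∀ n (f : ℕ → ℕ) → ∑< (suc n) f ≡ ∑< n f + f n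
∑<-last zero    f = ℕ.+-comm (f 0) 0
∑<-last (suc n) f = trans (cong (f 0 +_) (∑<-last n (f ∘ suc))) (sym (ℕ.+-assoc (f 0) _ _))

module _ {k} (m : Vec ℕ k) where

  private
    -- A nonzero tuple fits into m at most S times, so the multiplicities that matter are the `B`
    -- numbers from 0 to S.
    S B : ℕ
    S = Vec.sum m
    B = suc S

  -- Nothing is left to count once more than the total degree of m is spent. This makes the
  -- truncated sums exact.
  Supported : (Vec ℕ k → ℕ) → Set
  Supported φ = ∀ w → S < Vec.sum w → φ w ≡ 0

  -- If φ w counts the products of degree m - w of some irreducibles, then
  -- adjoin n d φ w allows in addition up to n - 1 factors of one further
  -- irreducible of degree d, and adjoinMultisets r d φ w allows factors from r
  -- further irreducibles of degree d.
  adjoin : ℕ → Vec ℕ k → (Vec ℕ k → ℕ) → Vec ℕ k → ℕ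
  adjoin zero    d φ w = 0
  adjoin (suc n) d φ w = φ w + adjoin n d φ (w +ᵛ d)

  adjoin-cong : ∀ n d {φ ψ : Vec ℕ k → ℕ} → (∀ w → φ w ≡ ψ w) → ∀ w → adjoin n d φ w ≡ adjoin n d ψ w
  adjoin-cong zero    d φ≗ψ w = refl
  adjoin-cong (suc n) d φ≗ψ w = cong₂ _+_ (φ≗ψ w) (adjoin-cong n d φ≗ψ (w +ᵛ d))

  adjoinMultisets : ℕ → Vec ℕ k → (Vec ℕ k → ℕ) → Vec ℕ k → ℕ
  adjoinMultisets n d φ w = ∑< B λ a → multisets n a * φ (w +ᵛ a ∙ᵛ d)

  adjoinMultisets-cong : ∀ n d {φ ψ : Vec ℕ k → ℕ} → (∀ w → φ w ≡ ψ w) →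
    ∀ w → adjoinMultisets n d φ w ≡ adjoinMultisets n d ψ w
  adjoinMultisets-cong n d φ≗ψ w = ∑<-cong B λ a → cong (multisets n a *_) (φ≗ψ (w +ᵛ a ∙ᵛ d))

  adjoinMultisets-0 : ∀ d (φ : Vec ℕ k → ℕ) w → adjoinMultisets 0 d φ w ≡ φ w
  adjoinMultisets-0 d φ w = trans (cong₂ _+_ (ℕ.*-identityˡ _)
      (∑<-0 S λ a → cong (_* φ (w +ᵛ suc a ∙ᵛ d)) (multisets-empty a)))
    (trans (ℕ.+-identityʳ _) (cong φ (trans (cong (w +ᵛ_) (0∙ᵛ d)) (+ᵛ-identityʳ w))))

  adjoinMultisets-supported : ∀ n d {φ} → Supported φ → Supported (adjoinMultisets n d φ)
  adjoinMultisets-supported n d {φ} φ-supported w S<w = ∑<-0 B λ a → trans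
    (cong (multisets n a *_) (φ-supported (w +ᵛ a ∙ᵛ d) (ℕ.<-≤-trans S<w
      (ℕ.≤-trans (ℕ.m≤m+n _ _) (ℕ.≤-reflexive (sym (sum-+ᵛ w (a ∙ᵛ d))))))))
    (ℕ.*-zeroʳ (multisets n a))

  -- Pascal's rule in each term, or (1 - x^d)^(-n-1) = (1 - x^d)^(-n) + x^d (1 - x^d)^(-n-1).
  adjoinMultisets-suc : ∀ n d {φ} → 0 < Vec.sum d → Supported φ → ∀ w →
    adjoinMultisets (suc n) d φ w ≡ adjoinMultisets n d φ w + adjoinMultisets (suc n) d φ (w +ᵛ d)
  adjoinMultisets-suc n d {φ} 0<d φ-supported w = begin
    -- The term a = 0 is split off. `multisets n 0` computes to 1 for n = 0 too, so this is also the
    -- head of the sum for n.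
    1 * φ (w +ᵛ 0 ∙ᵛ d) + ∑< S (λ a → multisets (suc n) (suc a) * φ (w +ᵛ suc a ∙ᵛ d))
      ≡⟨ cong (1 * φ (w +ᵛ 0 ∙ᵛ d) +_) (trans (∑<-cong S split) (∑<-+ S _ _)) ⟩
    1 * φ (w +ᵛ 0 ∙ᵛ d) + (∑< S (λ a → multisets n (suc a) * φ (w +ᵛ suc a ∙ᵛ d)) + ∑< S shifted)
      ≡⟨ ℕ.+-assoc (1 * φ (w +ᵛ 0 ∙ᵛ d)) _ _ ⟨
    adjoinMultisets n d φ w + ∑< S shifted
      -- Shifting a by one loses the term a = S, which is zero because S + 1 copies of d exceed m.
      ≡⟨ cong (adjoinMultisets n d φ w +_) (trans (∑<-last S shifted)
          (trans (cong (∑< S shifted +_) last≡0) (ℕ.+-identityʳ _))) ⟨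
    adjoinMultisets n d φ w + adjoinMultisets (suc n) d φ (w +ᵛ d) ∎
    where
    open ≡-Reasoning
    shifted : ℕ → ℕ
    shifted a = multisets (suc n) a * φ ((w +ᵛ d) +ᵛ a ∙ᵛ d)
    split : ∀ a → multisets (suc n) (suc a) * φ (w +ᵛ suc a ∙ᵛ d) ≡
      multisets n (suc a) * φ (w +ᵛ suc a ∙ᵛ d) + shifted a
    split a = trans (cong (_* φ (w +ᵛ suc a ∙ᵛ d)) (multisets-pascal n a))
      (trans (ℕ.*-distribʳ-+ _ (multisets n (suc a)) (multisets (suc n) a))
        (cong (λ v → multisets n (suc a) * φ (w +ᵛ suc a ∙ᵛ d) + multisets (suc n) a * φ v)
          (trans (cong (w +ᵛ_) (suc∙ᵛ a d)) (sym (+ᵛ-assoc w d (a ∙ᵛ d))))))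
    last≡0 : shifted S ≡ 0
    last≡0 = trans (cong (multisets (suc n) S *_) (φ-supported _ (<-sum-∙ᵛ S w 0<d)))
      (ℕ.*-zeroʳ (multisets (suc n) S))

  -- Pascal's rule, unfolded again and again in its last summand, produces the terms of `adjoin`.
  -- Each unfolding adds at least 1 to the total degree of w, so after b of them both sides vanish
  -- by the support condition.
  adjoin-adjoinMultisets : ∀ n d {φ} → 0 < Vec.sum d → Supported φ → ∀ w →
    adjoin B d (adjoinMultisets n d φ) w ≡ adjoinMultisets (suc n) d φ w
  adjoin-adjoinMultisets n d {φ} 0<d φ-supported w = go B w (ℕ.m≤m+n B (Vec.sum w))
    where
    go : ∀ b w → S < b + Vec.sum w → adjoin b d (adjoinMultisets n d φ) w ≡ adjoinMultisets (suc n) d φ w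
    go zero    w S<w = sym (adjoinMultisets-supported (suc n) d φ-supported w S<w)
    go (suc b) w S<b+w = trans
      (cong (adjoinMultisets n d φ w +_) (go b (w +ᵛ d) (ℕ.<-≤-trans S<b+w (ℕ.≤-trans
        (ℕ.≤-reflexive (sym (ℕ.+-suc b (Vec.sum w))))
        (ℕ.+-monoʳ-≤ b (ℕ.≤-trans (ℕ.m<m+n (Vec.sum w) 0<d) (ℕ.≤-reflexive (sym (sum-+ᵛ w d)))))))))
      (sym (adjoinMultisets-suc n d 0<d φ-supported w))

  infix 5 _at-m_
  -- Moves the condition on the weight from the range of summation into the summand, so that the sum
  -- can be split index by index.
  _at-m_ : ℕ → Vec ℕ k → ℕ
  x at-m u = if does (Vec.≡-dec ℕ._≟_ u m) then x else 0

  at-m-*ˡ : ∀ x y u → x * y at-m u ≡ x * (y at-m u)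
  at-m-*ˡ x y u with does (Vec.≡-dec ℕ._≟_ u m)
  ... | true  = refl
  ... | false = sym (ℕ.*-zeroʳ x)

  at-m-supported : Supported (1 at-m_)
  at-m-supported w S<w with Vec.≡-dec ℕ._≟_ w m
  ... | yes refl = contradiction S<w (ℕ.<-irrefl refl)
  ... | no  _    = refl

  -- The sum over families as an iterated sum, where w is the weight of the multiplicities already
  -- chosen.
  adjoinFamily : (Vec ℕ k → ℕ) → List (Vec ℕ k) → Vec ℕ k → ℕ
  adjoinFamily J = foldr (λ i → adjoinMultisets (J i) i) (1 at-m_)

  adjoinFamily-supported : ∀ J is → Supported (adjoinFamily J is)
  adjoinFamily-supported J []       = at-m-supported
  adjoinFamily-supported J (i ∷ is) = adjoinMultisets-supported (J i) i (adjoinFamily-supported J is)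

  adjoinFamily-cong : ∀ {J K : Vec ℕ k → ℕ} is → (∀ {i} → i ∈ is → J i ≡ K i) →
    ∀ w → adjoinFamily J is w ≡ adjoinFamily K is w
  adjoinFamily-cong []       J≗K w = refl
  adjoinFamily-cong {J} {K} (i ∷ is) J≗K w = trans
    (cong (λ n → adjoinMultisets n i (adjoinFamily J is) w) (J≗K (here refl)))
    (adjoinMultisets-cong (K i) i (adjoinFamily-cong is (J≗K ∘ there)) w)

  private
    -- `weight` and `familyProduct` for an arbitrary list in place of `between m`, to allow
    -- induction on it.
    weightOf : (is : List (Vec ℕ k)) → Vec ℕ (length is) → Vec ℕ k
    weightOf is a = Vec.foldr′ (zipWith _+_) 𝟎 (zipWith (λ aᵢ i → Vec.map (aᵢ *_) i) a (fromList is))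

    productOf : (Vec ℕ k → ℕ) → (is : List (Vec ℕ k)) → Vec ℕ (length is) → ℕ
    productOf J is a = product (toList (zipWith (λ aᵢ i → multisets (J i) aᵢ) a (fromList is)))

  sum-map-cartesianProductWith : ∀ {a b c} {A : Set a} {B : Set b} {C : Set c}
    (f : C → ℕ) (g : A → B → C) xs ys →
    sum (map f (cartesianProductWith g xs ys)) ≡ sum (map (λ x → sum (map (λ y → f (g x y)) ys)) xs)
  sum-map-cartesianProductWith f g []       ys = refl
  sum-map-cartesianProductWith f g (x ∷ xs) ys = begin
    sum (map f (map (g x) ys ++ cartesianProductWith g xs ys))
      ≡⟨ cong sum (List.map-++ f (map (g x) ys) _) ⟩
    sum (map f (map (g x) ys) ++ map f (cartesianProductWith g xs ys))
      ≡⟨ sum-++ (map f (map (g x) ys)) _ ⟩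
    sum (map f (map (g x) ys)) + sum (map f (cartesianProductWith g xs ys))
      ≡⟨ cong₂ _+_ (cong sum (sym (List.map-∘ ys))) (sum-map-cartesianProductWith f g xs ys) ⟩
    sum (map (λ y → f (g x y)) ys) + sum (map (λ x → sum (map (λ y → f (g x y)) ys)) xs) ∎
    where open ≡-Reasoning

  sum-map-*ˡ : ∀ {a} {A : Set a} x (f : A → ℕ) ys → sum (map (λ y → x * f y) ys) ≡ x * sum (map f ys)
  sum-map-*ˡ x f []       = sym (ℕ.*-zeroʳ x)
  sum-map-*ˡ x f (y ∷ ys) = trans (cong (x * f y +_) (sum-map-*ˡ x f ys)) (sym (ℕ.*-distribˡ-+ x (f y) _))

  -- The box of families is a cartesian product. Choosing a for the first index i contributes the
  -- factor `multisets (J i) a` and moves w to w + a i.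
  sum-families : ∀ J is w →
    sum (map (λ a → productOf J is a at-m (w +ᵛ weightOf is a)) (box (replicate (length is) S))) ≡
    adjoinFamily J is w
  sum-families J []       w = trans (ℕ.+-identityʳ _) (cong (1 at-m_) (+ᵛ-identityʳ w))
  sum-families J (i ∷ is) w = begin
    sum (map term (cartesianProductWith _∷_ (upTo B) families′))
      ≡⟨ sum-map-cartesianProductWith term _∷_ (upTo B) families′ ⟩
    sum (map (λ a → sum (map (λ as → term (a ∷ as)) families′)) (upTo B))
      ≡⟨ cong sum (List.map-upTo _ B) ⟩
    ∑< B (λ a → sum (map (λ as → term (a ∷ as)) families′))
      ≡⟨ ∑<-cong B (λ a → trans
          (cong sum (List.map-cong (λ as → trans
            (cong (productOf J (i ∷ is) (a ∷ as) at-m_) (sym (+ᵛ-assoc w (a ∙ᵛ i) (weightOf is as))))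
            (at-m-*ˡ (multisets (J i) a) (productOf J is as) ((w +ᵛ a ∙ᵛ i) +ᵛ weightOf is as))) families′))
          (trans (sum-map-*ˡ (multisets (J i) a) _ families′)
            (cong (multisets (J i) a *_) (sum-families J is (w +ᵛ a ∙ᵛ i))))) ⟩
    adjoinFamily J (i ∷ is) w ∎
    where
    open ≡-Reasoning
    families′ : List (Vec ℕ (length is))
    families′ = box (replicate (length is) S)
    term : Vec ℕ (suc (length is)) → ℕ
    term a = productOf J (i ∷ is) a at-m (w +ᵛ weightOf (i ∷ is) a)

  sum-map-filter : ∀ {a p} {A : Set a} {P : Pred A p} (P? : Decidable P) (f : A → ℕ) xs →
    sum (map f (filter P? xs)) ≡ sum (map (λ x → if does (P? x) then f x else 0) xs)
  sum-map-filter P? f []       = refl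
  sum-map-filter P? f (x ∷ xs) with does (P? x)
  ... | true  = cong (f x +_) (sum-map-filter P? f xs)
  ... | false = sum-map-filter P? f xs

  familySum≡adjoinFamily : ∀ J → familySum J m ≡ adjoinFamily J (between m) 𝟎
  familySum≡adjoinFamily J = begin
    familySum J m
      ≡⟨ sum-map-filter (λ a → Vec.≡-dec ℕ._≟_ (weight m a) m) (familyProduct J m) (box (replicate _ S)) ⟩
    sum (map (λ a → familyProduct J m a at-m weight m a) (box (replicate _ S)))
      ≡⟨ cong sum (List.map-cong (λ a → cong (familyProduct J m a at-m_) (sym (+ᵛ-identityˡ (weight m a)))) (box (replicate _ S))) ⟩
    sum (map (λ a → familyProduct J m a at-m (𝟎 +ᵛ weight m a)) (box (replicate _ S)))
      ≡⟨ sum-families J (between m) 𝟎 ⟩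
    adjoinFamily J (between m) 𝟎 ∎
    where open ≡-Reasoning

open import Data.Integer.Base as ℤ using (+_; _-_)

-- Systems of representatives and cardinalities

module _ {a ℓ} (S : Setoid a ℓ) where
  private module S = Setoid S
  open S using (_≈_; _≉_)

  -- A system of representatives for the classes in `P`. Unlike bijections with `Fin n`, lists can
  -- be concatenated and mapped directly.
  record Enumerates {p} (P : Pred S.Carrier p) (xs : List S.Carrier) : Set (a ⊔ ℓ ⊔ p) where
    field
      members  : All P xs
      distinct : AllPairs _≉_ xs
      complete : ∀ {x} → P x → Any (x ≈_) xs

  lookup-distinct : ∀ {xs} → AllPairs _≉_ xs → ∀ i j → List.lookup xs i ≈ List.lookup xs j → i ≡ j
  lookup-distinct {x ∷ xs} (_ ∷ _)    zero    zero    _  = refl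
  lookup-distinct {x ∷ xs} (x≉ ∷ _)   zero    (suc j) eq = contradiction eq (All.lookup x≉ (∈-lookup j))
  lookup-distinct {x ∷ xs} (x≉ ∷ _)   (suc i) zero    eq = contradiction (S.sym eq) (All.lookup x≉ (∈-lookup i))
  lookup-distinct {x ∷ xs} (_ ∷ xs≉)  (suc i) (suc j) eq = cong suc (lookup-distinct xs≉ i j eq)

  module _ {p} {P : Pred S.Carrier p} where

    enumerates⇒cardinality : ∀ {xs} → Enumerates P xs →
      HasCardinality (On.setoid {B = Σ S.Carrier P} S proj₁) (length xs)
    enumerates⇒cardinality {xs} enumerates = record
      { to        = index
      ; from      = λ i → List.lookup xs i , All.lookup E.members (∈-lookup i)
      ; to-cong   = λ {x} {y} x≈y → lookup-distinct E.distinct _ _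
          (S.trans (S.sym (≈-index x)) (S.trans x≈y (≈-index y)))
      ; from-cong = λ { refl → S.refl }
      ; inverse   = (λ {i} {x} x≈i → lookup-distinct E.distinct _ _ (S.trans (S.sym (≈-index x)) x≈i)) ,
                    (λ { {x} refl → S.sym (≈-index x) }) }
      where
      module E = Enumerates enumerates
      index : Σ S.Carrier P → Fin (length xs)
      index (x , px) = Any.index (E.complete px)
      ≈-index : ∀ x → proj₁ x ≈ List.lookup xs (index x)
      ≈-index (x , px) = Any.lookup-index (E.complete px)

    cardinality⇒enumerates : ∀ {n} (card : HasCardinality (On.setoid {B = Σ S.Carrier P} S proj₁) n) →
      Enumerates P (tabulate (proj₁ ∘ Inverse.from card))
    cardinality⇒enumerates card = record
      { members  = All.tabulate⁺ (proj₂ ∘ Inverse.from card)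
      ; distinct = AllPairs.tabulate⁺ λ {i} {j} i≢j eq → i≢j (trans (sym (Inverse.inverseˡ card {i} {Inverse.from card i} S.refl))
          (Inverse.inverseˡ card eq))
      ; complete = λ {x} px → Any.tabulate⁺ (Inverse.to card (x , px)) (S.sym (Inverse.inverseʳ card refl)) }

    -- A sieve: an entry is kept if it satisfies `P` and is equivalent to none of those kept from
    -- the tail.
    covered⇒enumerates : (∀ x y → Dec (x ≈ y)) → (∀ x → Dec (P x)) → (∀ {x y} → x ≈ y → P x → P y) →
      ∀ xs → (∀ {x} → P x → Any (x ≈_) xs) → ∃ (Enumerates P)
    covered⇒enumerates _≟_ P? resp xs covered with go xs
      where
      go : ∀ xs → ∃ λ ys → All P ys × AllPairs _≉_ ys × (∀ {x} → P x → Any (x ≈_) xs → Any (x ≈_) ys)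
      go [] = [] , [] , [] , λ _ ()
      go (x ∷ xs) with go xs | P? x
      ... | ys , ys∈ , ys≉ , complete | no ¬px = ys , ys∈ , ys≉ ,
        λ { py (here y≈x) → contradiction (resp y≈x py) ¬px ; py (there y∈) → complete py y∈ }
      ... | ys , ys∈ , ys≉ , complete | yes px with Any.any? (x ≟_) ys
      ...   | yes x∈ = ys , ys∈ , ys≉ ,
        λ { py (here y≈x) → Any.map (S.trans y≈x) x∈ ; py (there y∈) → complete py y∈ }
      ...   | no x∉  = x ∷ ys , px ∷ ys∈ , All.¬Any⇒All¬ ys x∉ ∷ ys≉ ,
        λ { py (here y≈x) → here y≈x ; py (there y∈) → there (complete py y∈) }
    ... | ys , ys∈ , ys≉ , complete = ys , record
      { members = ys∈ ; distinct = ys≉ ; complete = λ px → complete px (covered px) }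

cardinality-unique : ∀ {a ℓ} {S : Setoid a ℓ} {m n} → HasCardinality S m → HasCardinality S n → m ≡ n
cardinality-unique card card′ = ↔⇒≡ (Composition.inverse (Symmetry.inverse card) card′)

-- The componentwise order and the tuples strictly between `𝟎` and m

𝟎≤ᵛ : ∀ {k} (u : Vec ℕ k) → 𝟎 ≤ᵛ u
𝟎≤ᵛ []      = []
𝟎≤ᵛ (_ ∷ u) = z≤n ∷ 𝟎≤ᵛ u

≤ᵛ-+ᵛ : ∀ {k} (u v : Vec ℕ k) → v ≤ᵛ u +ᵛ v
≤ᵛ-+ᵛ []      []      = []
≤ᵛ-+ᵛ (a ∷ u) (b ∷ v) = ℕ.m≤n+m b a ∷ ≤ᵛ-+ᵛ u v

+ᵛ≡⇒≡𝟎 : ∀ {k} (u v : Vec ℕ k) → u +ᵛ v ≡ v → u ≡ 𝟎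
+ᵛ≡⇒≡𝟎 u v eq = sum≡0⇒≡𝟎 u (ℕ.+-cancelʳ-≡ (Vec.sum v) (Vec.sum u) 0 (trans (sym (sum-+ᵛ u v)) (cong Vec.sum eq)))

sum-mono : ∀ {k} {u v : Vec ℕ k} → u ≤ᵛ v → Vec.sum u ≤ Vec.sum v
sum-mono []        = z≤n
sum-mono (p ∷ u≤v) = ℕ.+-mono-≤ p (sum-mono u≤v)

sum-strict : ∀ {k} {u v : Vec ℕ k} → u <ᵛ v → Vec.sum u < Vec.sum v
sum-strict (u≤v , u≢v) = ℕ.≤∧≢⇒< (sum-mono u≤v) λ eq → u≢v (≤∧sum≡⇒≡ u≤v eq)
  where
  ≤∧sum≡⇒≡ : ∀ {k} {u v : Vec ℕ k} → u ≤ᵛ v → Vec.sum u ≡ Vec.sum v → u ≡ v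
  ≤∧sum≡⇒≡ []        _  = refl
  ≤∧sum≡⇒≡ {u = a ∷ u} {b ∷ v} (a≤b ∷ u≤v) eq with ℕ.m≤n⇒m<n∨m≡n a≤b
  ... | inj₁ a<b  = contradiction eq (ℕ.<⇒≢ (ℕ.+-mono-<-≤ a<b (sum-mono u≤v)))
  ... | inj₂ refl = cong (a ∷_) (≤∧sum≡⇒≡ u≤v (ℕ.+-cancelˡ-≡ a _ _ eq))

∈-box : ∀ {k} {u m : Vec ℕ k} → u ≤ᵛ m → u ∈ box m
∈-box []        = here refl
∈-box (p ∷ u≤m) = ∈-cartesianProductWith⁺ _∷_ (∈-upTo⁺ (s≤s p)) (∈-box u≤m)

box-unique : ∀ {k} (m : Vec ℕ k) → Unique (box m)
box-unique []      = [] ∷ []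
box-unique (n ∷ m) = Unique.cartesianProductWith⁺ _∷_ Vec.∷-injective (Unique.upTo⁺ (suc n)) (box-unique m)

module _ {k} (m : Vec ℕ k) where
  private
    inside? : ∀ i → Dec (𝟎 <ᵛ i × i <ᵛ m)
    inside? i = (𝟎 <ᵛ? i) ×-dec (i <ᵛ? m)

  ∈-between⁺ : ∀ {i} → 𝟎 <ᵛ i → i <ᵛ m → i ∈ between m
  ∈-between⁺ 0<i i<m = ∈-filter⁺ inside? (∈-box (proj₁ i<m)) (0<i , i<m)

  ∈-between⁻ : ∀ {i} → i ∈ between m → 𝟎 <ᵛ i × i <ᵛ m
  ∈-between⁻ i∈ = proj₂ (∈-filter⁻ inside? {xs = box m} i∈)

  between-unique : Unique (between m)
  between-unique = Unique.filter⁺ inside? (box-unique m)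

-- Counting products of irreducible polynomials

module Counting {q c ℓ} (F : FiniteField q c ℓ) (k : ℕ) where
  private module F = FiniteField F
  open Multivariate F
  open PolynomialsOver F
  open UniqueFactorization F
  open Ring k using (_≈_; 1#) renaming (_*_ to _⊛_)
  private
    module K = Ring k
    module L = RingLemmas (polynomials F.commutativeRing k)
    module A = Setoid (associatedSetoid k)
  open L using (_∣_; _∤_)

  infix 4 _∼_
  _∼_ : Poly k → Poly k → Set (c ⊔ ℓ)
  _∼_ = Associated k

  irreducible-deg? : ∀ m (f : Poly k) → Dec (HasDeg f m × IsIrreducible k f)
  irreducible-deg? m f with deg? {k} f m
  ... | no ¬fₘ = no λ (fₘ , _) → ¬fₘ (vectorDegree {m = m} fₘ)
  ... | yes fₘ = Dec.map′ (hasDeg fₘ ,_) proj₂ (irreducible? k fₘ)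

  polys-cover : ∀ m {f : Poly k} → HasDeg f m → Any (f ∼_) (polys m)
  polys-cover m {f} fₘ = Any.map (≈⇒associated k) (deg⇒∈polys {k} {f} {m} (vectorDegree {m = m} fₘ) (λ i → ℕ.≤-refl))

  counts : Counts F k
  counts = record
    { N        = λ m → length (proj₁ (normalized m))
    ; I        = λ m → length (proj₁ (irreducibles m))
    ; N-counts = λ m → enumerates⇒cardinality (associatedSetoid k) (proj₂ (normalized m))
    ; I-counts = λ m → enumerates⇒cardinality (associatedSetoid k) (proj₂ (irreducibles m)) }
    where
    normalized : ∀ m → ∃ (Enumerates (associatedSetoid k) (λ f → HasDeg f m))
    normalized m = covered⇒enumerates (associatedSetoid k) (associated? k)
      (λ f → Dec.map′ hasDeg (vectorDegree {m = m}) (deg? {k} f m))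
      (λ f~g fₘ → hasDeg (deg-resp-associated f~g (vectorDegree {m = m} fₘ)))
      (polys m) (polys-cover m)
    irreducibles : ∀ m → ∃ (Enumerates (associatedSetoid k) (λ f → HasDeg f m × IsIrreducible k f))
    irreducibles m = covered⇒enumerates (associatedSetoid k) (associated? k)
      (irreducible-deg? m)
      (λ f~g (fₘ , f-irr) → hasDeg (deg-resp-associated f~g (vectorDegree {m = m} fₘ)) , irreducible-resp-associated k f~g f-irr)
      (polys m) (λ (fₘ , _) → polys-cover m fₘ)

  record IrreduciblePolynomial : Set (c ⊔ ℓ) where
    field
      poly        : Poly k
      degree      : Vec ℕ k
      hasDegree   : VectorDegree k poly degree
      irreducible : IsIrreducible k poly

    degree≢𝟎 : degree ≢ 𝟎
    degree≢𝟎 = nonunit⇒deg≢𝟎 hasDegree (L.Irreducible.p∤1 irreducible)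

  open IrreduciblePolynomial

  -- For nonzero f this says that f is a unit times a product of members of `ps`, in a form that
  -- needs no choice of factorization.
  FactorsIn : List IrreduciblePolynomial → Poly k → Set (c ⊔ ℓ)
  FactorsIn ps f = ∀ {r} → IsIrreducible k r → r ∣ f → Any (λ p → r ∼ poly p) ps

  noFactors⇒unit : ∀ {f n} → VectorDegree k f n → FactorsIn [] f → f ∣ 1#
  noFactors⇒unit {f} fₙ f∈ with unit? k f
  ... | yes f∣1 = f∣1
  ... | no  f∤1 with irreducibleDivisor k fₙ f∤1
  ...   | p , p-irr , p∣f = contradiction (f∈ p-irr p∣f) λ ()

  module _ (m : Vec ℕ k) where

    private
      S B : ℕ
      S = Vec.sum m
      B = suc S

    Complementary : Vec ℕ k → Poly k → Set ℓ
    Complementary w f = ∃ λ n → VectorDegree k f n × w +ᵛ n ≡ m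

    ProductOf : List IrreduciblePolynomial → Vec ℕ k → Poly k → Set (c ⊔ ℓ)
    ProductOf ps w f = Complementary w f × FactorsIn ps f

    empty : Vec ℕ k → List (Poly k)
    empty w with Vec.≡-dec ℕ._≟_ w m
    ... | yes _ = 1# ∷ []
    ... | no  _ = []

    -- The list counterpart of `adjoin`, with `T` for φ. Since `T` is to avoid p, the number of
    -- passes is the multiplicity of p, which n bounds strictly.
    extend : ℕ → IrreduciblePolynomial → (Vec ℕ k → List (Poly k)) → Vec ℕ k → List (Poly k)
    extend zero    p T w = []
    extend (suc n) p T w = T w ++ map (poly p ⊛_) (extend n p T (w +ᵛ degree p))

    -- The products of degree m - w of members of ps. Multiplying by p is paid
    -- for by adding the degree of p to w.
    products : List IrreduciblePolynomial → Vec ℕ k → List (Poly k)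
    products = foldr (extend B) empty

    empty-enumerates : ∀ w → Enumerates (associatedSetoid k) (ProductOf [] w) (empty w)
    empty-enumerates w with Vec.≡-dec ℕ._≟_ w m
    ... | yes refl = record
      { members  = ((𝟎 , deg-1 k , +ᵛ-identityʳ w) ,
          λ r-irr r∣1 → contradiction r∣1 (L.Irreducible.p∤1 r-irr)) ∷ []
      ; distinct = [] ∷ []
      ; complete = λ {f} ((n , fₙ , _) , f∈) → here (unit-*⇒associated k (noFactors⇒unit fₙ f∈) (K.*-identityʳ f)) }
    ... | no w≢m = record
      { members  = []
      ; distinct = []
      ; complete = λ {f} → λ { ((n , fₙ , w+n≡m) , f∈) → ⊥-elim (w≢m (
          trans (sym (+ᵛ-identityʳ w)) (trans (cong (w +ᵛ_) (sym (deg-unique fₙ (unit⇒deg-𝟎 {k} (noFactors⇒unit fₙ f∈))))) w+n≡m))) } }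

    module _ {p : IrreduciblePolynomial} {ps : List IrreduciblePolynomial} {T : Vec ℕ k → List (Poly k)}
      (p∉ps : All (λ q → ¬ poly p ∼ poly q) ps)
      (T-enumerates : ∀ w → Enumerates (associatedSetoid k) (ProductOf ps w) (T w)) where
      private
        module T w = Enumerates (T-enumerates w)
        p≉0 : ¬ poly p ≈ K.0#
        p≉0 = nonzero (hasDegree p)

      extend-members : ∀ n w → All (ProductOf (p ∷ ps) w) (extend n p T w)
      extend-members zero    w = []
      extend-members (suc n) w = All.++⁺
        (All.map (λ (f° , f∈) → f° , λ r-irr r∣f → there (f∈ r-irr r∣f)) (T.members w))
        (All.map⁺ (All.map times-p (extend-members n (w +ᵛ degree p))))
        where
        times-p : ∀ {f} → ProductOf (p ∷ ps) (w +ᵛ degree p) f → ProductOf (p ∷ ps) w (poly p ⊛ f)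
        times-p ((a , fₐ , eq) , f∈) =
          (degree p +ᵛ a , deg-* (hasDegree p) fₐ , trans (sym (+ᵛ-assoc w (degree p) a)) eq) ,
          -- An irreducible r is prime, so it divides p, and is then associated to it, or it divides
          -- f.
          λ r-irr r∣pf → [ (λ r∣p → here (A.sym (irreducible-∣⇒associated k (irreducible p) r-irr r∣p))) , f∈ r-irr ]′
            (L.Prime.split-∣ (irreducible⇒prime k r-irr) r∣pf)

      -- A product from `T` is not associated to a multiple of p: p would divide it and hence be
      -- associated to a member of `ps`. Among the multiples of p, the factor p cancels.
      extend-distinct : ∀ n w → AllPairs (λ f g → ¬ f ∼ g) (extend n p T w)
      extend-distinct zero    w = []
      extend-distinct (suc n) w = AllPairs.++⁺ (T.distinct w)
        (AllPairs.map⁺ (AllPairs.map (λ f≁g pf∼pg → f≁g (associated-cancel k p≉0 pf∼pg))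
          (extend-distinct n (w +ᵛ degree p))))
        (All.map (λ (_ , f∈) → All.map⁺ (All.universal (λ g f∼pg →
            contradiction (f∈ (irreducible p) (L.∣-trans (g , K.*-comm g (poly p)) (associated⇒∣ k f∼pg)))
              (All.All¬⇒¬Any p∉ps)) _))
          (T.members w))

      -- Divide by p as long as possible. Each division raises the total degree of w, so n plus that
      -- degree stays above S; at n = 0 no complement of w in m could exist.
      extend-complete : ∀ n w {f} → S < n ℕ.+ Vec.sum w → ProductOf (p ∷ ps) w f → Any (f ∼_) (extend n p T w)
      extend-complete zero    w S<w ((a , fₐ , refl) , _) =
        contradiction S<w (ℕ.≤⇒≯ (ℕ.≤-trans (ℕ.m≤m+n _ _) (ℕ.≤-reflexive (sym (sum-+ᵛ w a)))))
      extend-complete (suc n) w {f} S<n+w ((a , fₐ , w+a≡m) , f∈) with divides? k (poly p) fₐ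
      ... | no p∤f = Any.++⁺ˡ (T.complete w ((a , fₐ , w+a≡m) ,
        λ {r} r-irr r∣f → Any.tail (λ r∼p → p∤f (L.∣-trans (associated⇒∣ k r∼p) r∣f)) (f∈ r-irr r∣f)))
      ... | yes (g , gp≈f) with deg-factors {k} {f} {g} {poly p} gp≈f fₐ
      ...   | b , d , g_b , p_d , b+d≡a with deg-unique p_d (hasDegree p)
      ...     | refl = Any.++⁺ʳ (T w) (Any.map⁺ (Any.map
        (λ g∼h → A.trans (≈⇒associated k (K.trans (K.sym gp≈f) (K.*-comm g (poly p)))) (associated-* k (poly p) g∼h))
        (extend-complete n (w +ᵛ degree p)
          (ℕ.<-≤-trans S<n+w (ℕ.≤-trans (ℕ.≤-reflexive (sym (ℕ.+-suc n (Vec.sum w)))) (ℕ.+-monoʳ-≤ n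
            (ℕ.≤-trans (ℕ.m<m+n (Vec.sum w) (≢𝟎⇒0<sum (degree≢𝟎 p))) (ℕ.≤-reflexive (sym (sum-+ᵛ w (degree p))))))))
          ((b , g_b , trans (+ᵛ-assoc w (degree p) b) (trans (cong (w +ᵛ_)
              (trans (Vec.zipWith-comm ℕ.+-comm (degree p) b) b+d≡a)) w+a≡m)) ,
            λ r-irr r∣g → f∈ r-irr (L.∣-respʳ gp≈f (L.∣-*ʳ (poly p) r∣g))))))

    products-enumerates : ∀ {ps} → AllPairs (λ p q → ¬ poly p ∼ poly q) ps →
      ∀ w → Enumerates (associatedSetoid k) (ProductOf ps w) (products ps w)
    products-enumerates []            w = empty-enumerates w
    products-enumerates (p∉ps ∷ ps≁) w = record
      { members  = extend-members p∉ps (products-enumerates ps≁) B w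
      ; distinct = extend-distinct p∉ps (products-enumerates ps≁) B w
      ; complete = extend-complete p∉ps (products-enumerates ps≁) B w (ℕ.m≤m+n B (Vec.sum w)) }

    length-empty : ∀ w → length (empty w) ≡ (_at-m_ m 1 w)
    length-empty w with Vec.≡-dec ℕ._≟_ w m
    ... | yes _ = refl
    ... | no  _ = refl

    length-extend : ∀ n p T w → length (extend n p T w) ≡ adjoin m n (degree p) (λ v → length (T v)) w
    length-extend zero    p T w = refl
    length-extend (suc n) p T w = trans (List.length-++ (T w)) (cong (length (T w) ℕ.+_)
      (trans (List.length-map (poly p ⊛_) (extend n p T (w +ᵛ degree p))) (length-extend n p T (w +ᵛ degree p))))

    -- The multiset numbers arise here: each irreducible of degree i contributes one more factor 1 /
    -- (1 - x^i).
    length-products-++ : ∀ {i ps qs} → Supported m (λ w → length (products qs w)) → All (λ p → degree p ≡ i) ps →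
      ∀ w → length (products (ps ++ qs) w) ≡ adjoinMultisets m (length ps) i (λ v → length (products qs v)) w
    length-products-++ {i} {_} {qs} _ [] w = sym (adjoinMultisets-0 m i (λ v → length (products qs v)) w)
    length-products-++ {_} {p ∷ ps} {qs} qs-supported (refl ∷ ps-degree) w = trans
      (length-extend B p (products (ps ++ qs)) w)
      (trans (adjoin-cong m B (degree p) (length-products-++ qs-supported ps-degree) w)
        (adjoin-adjoinMultisets m (length ps) (degree p) (≢𝟎⇒0<sum (degree≢𝟎 p)) qs-supported w))

    length-products-concat : ∀ (J : Vec ℕ k → ℕ) (block : Vec ℕ k → List IrreduciblePolynomial) →
      (∀ i → length (block i) ≡ J i) → (∀ i → All (λ p → degree p ≡ i) (block i)) →
      ∀ is w → length (products (concatMap block is) w) ≡ adjoinFamily m J is w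
    length-products-concat J block length-block degree-block = go
      where
      go : ∀ is w → length (products (concatMap block is) w) ≡ adjoinFamily m J is w
      go []       w = length-empty w
      go (i ∷ is) w = trans
        -- The support condition for the remaining blocks is read off from the formula for their
        -- lengths.
        (length-products-++ (λ v S<v → trans (go is v) (adjoinFamily-supported m J is v S<v)) (degree-block i) w)
        (trans (cong (λ n → adjoinMultisets m n i (λ v → length (products (concatMap block is) v)) w) (length-block i))
          (adjoinMultisets-cong m (J i) i (go is) w))

  -- The formula for the number of irreducibles, and its uniqueness

  module _ (counts : Counts F k) where
    open Counts counts

    irreducibles : Vec ℕ k → List (Poly k)
    irreducibles i = tabulate (λ j → proj₁ (Inverse.from (I-counts i) j))

    irreducibles-enumerates : ∀ i → Enumerates (associatedSetoid k) (λ f → HasDeg f i × IsIrreducible k f) (irreducibles i)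
    irreducibles-enumerates i = cardinality⇒enumerates (associatedSetoid k) (I-counts i)

    irreduciblesOfDegree : Vec ℕ k → List IrreduciblePolynomial
    irreduciblesOfDegree i = tabulate λ j → let (f , fᵢ , f-irr) = Inverse.from (I-counts i) j in
      record { poly = f ; degree = i ; hasDegree = vectorDegree fᵢ ; irreducible = f-irr }

    map-poly : ∀ i → map poly (irreduciblesOfDegree i) ≡ irreducibles i
    map-poly i = List.map-tabulate _ poly

    irreduciblesBelow : Vec ℕ k → List IrreduciblePolynomial
    irreduciblesBelow m = concatMap irreduciblesOfDegree (between m)

    degree-irreduciblesOfDegree : ∀ i → All (λ p → degree p ≡ i) (irreduciblesOfDegree i)
    degree-irreduciblesOfDegree i = All.tabulate⁺ λ _ → refl

    -- Within one degree the enumeration separates the classes; across degrees the vector degree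
    -- does, being invariant under association.
    irreduciblesBelow-distinct : ∀ m → AllPairs (λ p q → ¬ poly p ∼ poly q) (irreduciblesBelow m)
    irreduciblesBelow-distinct m = AllPairs.concat⁺
      (All.map⁺ (All.universal (λ i → AllPairs.map⁻
        (≡.subst (AllPairs _) (sym (map-poly i)) (Enumerates.distinct (irreducibles-enumerates i)))) (between m)))
      (AllPairs.map⁺ (AllPairs.map (λ {i} {j} i≢j →
          All.map (λ { {p} refl → All.map (λ { {q} refl p∼q →
              i≢j (deg-unique (deg-resp-associated p∼q (hasDegree p)) (hasDegree q)) })
            (degree-irreduciblesOfDegree j) }) (degree-irreduciblesOfDegree i))
        (between-unique m)))

    degree-irreduciblesBelow : ∀ m → All (λ p → degree p <ᵛ m) (irreduciblesBelow m)
    degree-irreduciblesBelow m = All.concat⁺ (All.map⁺ (All.tabulate λ {i} i∈ →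
      All.map (λ { refl → proj₂ (∈-between⁻ m i∈) }) (degree-irreduciblesOfDegree i)))

    -- The degree of r is not `𝟎`, as r is no unit. If it were m, the cofactor would have degree
    -- `𝟎`, hence be a unit, and f would be associated to r.
    properDivisor : ∀ {m f r} → VectorDegree k f m → IsIrreducible k r → r ∣ f → ¬ f ∼ r →
      Any (λ p → r ∼ poly p) (irreduciblesBelow m)
    properDivisor {m} {f} {r} fₘ r-irr (g , gr≈f) f≁r with deg-factors {k} {f} {g} {r} gr≈f fₘ
    ... | a , b , gₐ , r_b , refl = Any.concat⁺ (Any.map⁺ (lose (∈-between⁺ m 𝟎<b b<m)
      (Any.map⁻ (≡.subst (Any (r ∼_)) (sym (map-poly b))
        (Enumerates.complete (irreducibles-enumerates b) (hasDeg r_b , r-irr))))))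
      where
      𝟎<b : 𝟎 <ᵛ b
      𝟎<b = 𝟎≤ᵛ b , λ 𝟎≡b → nonunit⇒deg≢𝟎 r_b (L.Irreducible.p∤1 r-irr) (sym 𝟎≡b)
      b<m : b <ᵛ m
      b<m = ≤ᵛ-+ᵛ a b , λ b≡a+b → f≁r (unit-*⇒associated k
        (deg-𝟎⇒unit (≡.subst (VectorDegree k g) (+ᵛ≡⇒≡𝟎 a b (sym b≡a+b)) gₐ)) gr≈f)

    normalized-enumerates : ∀ m → Enumerates (associatedSetoid k) (λ f → HasDeg f m)
      (irreducibles m ++ products m (irreduciblesBelow m) 𝟎)
    normalized-enumerates m = record
      { members  = All.++⁺ (All.map proj₁ I.members)
          (All.map (λ { ((n , fₙ , refl) , _) → ≡.subst (HasDeg _) (sym (+ᵛ-identityˡ n)) (hasDeg fₙ) }) P.members)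
      ; distinct = AllPairs.++⁺ I.distinct P.distinct
          (All.map (λ (fₘ , f-irr) → All.map (λ (_ , g∈) f∼g → irreducible∉products fₘ f-irr g∈ f∼g) P.members) I.members)
      ; complete = complete }
      where
      module I = Enumerates (irreducibles-enumerates m)
      module P = Enumerates (products-enumerates m (irreduciblesBelow-distinct m) 𝟎)
      -- As f divides g, it would be associated to an irreducible whose degree is not m.
      irreducible∉products : ∀ {f g} → HasDeg f m → IsIrreducible k f → FactorsIn (irreduciblesBelow m) g → ¬ f ∼ g
      irreducible∉products fₘ f-irr g∈ f∼g = All.lookupWith
        (λ {p} (_ , p≢m) f∼p → p≢m (deg-unique (hasDegree p) (deg-resp-associated f∼p (vectorDegree fₘ))))
        (degree-irreduciblesBelow m) (g∈ f-irr (associated⇒∣ k (A.sym f∼g)))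
      complete : ∀ {f} → HasDeg f m → Any (f ∼_) (irreducibles m ++ products m (irreduciblesBelow m) 𝟎)
      complete {f} fₘ with irreducible? k (vectorDegree {m = m} fₘ)
      ... | yes f-irr = Any.++⁺ˡ (I.complete (fₘ , f-irr))
      ... | no ¬f-irr = Any.++⁺ʳ (irreducibles m) (P.complete ((m , vectorDegree {m = m} fₘ , +ᵛ-identityˡ m) ,
        λ r-irr r∣f → properDivisor {m} (vectorDegree fₘ) r-irr r∣f
          λ f∼r → ¬f-irr (irreducible-resp-associated k (A.sym f∼r) r-irr)))

    N≡I+familySum : ∀ m → N m ≡ I m ℕ.+ familySum I m
    N≡I+familySum m = trans
      (cardinality-unique (N-counts m) (enumerates⇒cardinality (associatedSetoid k) (normalized-enumerates m)))
      (trans (List.length-++ (irreducibles m)) (≡.cong₂ ℕ._+_ (List.length-tabulate _)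
        (trans (length-products-concat m I irreduciblesOfDegree (λ i → List.length-tabulate _)
          degree-irreduciblesOfDegree (between m) 𝟎) (sym (familySum≡adjoinFamily m I)))))

    -- A polynomial of degree `𝟎` is a nonzero constant, hence a unit.
    I-𝟎 : I 𝟎 ≡ 0
    I-𝟎 with I 𝟎 | I-counts 𝟎
    ... | zero  | _    = refl
    ... | suc _ | card with Inverse.from card zero
    ...   | f , f₀ , f-irr = contradiction (deg-𝟎⇒unit (vectorDegree f₀)) (L.Irreducible.p∤1 f-irr)

    I-formula : ∀ m → + I m ≡ + N m - + familySum I m
    I-formula m = sym (begin
      + N m - + familySum I m                          ≡⟨ cong (λ n → + n - + familySum I m) (N≡I+familySum m) ⟩
      + I m ℤ.+ + familySum I m - + familySum I m      ≡⟨ ℤ.+-assoc (+ I m) (+ familySum I m) (ℤ.- (+ familySum I m)) ⟩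
      + I m ℤ.+ (+ familySum I m - + familySum I m)    ≡⟨ cong (λ z → + I m ℤ.+ z) (ℤ.+-inverseʳ (+ familySum I m)) ⟩
      + I m ℤ.+ (+ 0)                                  ≡⟨ ℤ.+-identityʳ (+ I m) ⟩
      + I m                                            ∎)
      where open ≡.≡-Reasoning

    -- `familySum J m` reads J only at tuples strictly below m, which have smaller total degree, so
    -- induction on the total degree applies.
    recursion-unique : (J : Vec ℕ k → ℕ) → J 𝟎 ≡ 0 →
      (∀ m → 𝟎 <ᵛ m → + J m ≡ + N m - + familySum J m) → ∀ m → J m ≡ I m
    recursion-unique J J-𝟎 J-formula m = go (suc (Vec.sum m)) m ℕ.≤-refl
      where
      go : ∀ n m → Vec.sum m < n → J m ≡ I m
      go (suc n) m (s≤s m≤n) with Vec.≡-dec ℕ._≟_ 𝟎 m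
      ... | yes refl = trans J-𝟎 (sym I-𝟎)
      ... | no 𝟎≢m = ℤ.+-injective (trans (J-formula m (𝟎≤ᵛ m , 𝟎≢m))
        (trans (cong (λ s → + N m - + s) familySums≡) (sym (I-formula m))))
        where
        familySums≡ : familySum J m ≡ familySum I m
        familySums≡ = trans (familySum≡adjoinFamily m J) (trans
          (adjoinFamily-cong m (between m)
            (λ {i} i∈ → go n i (ℕ.<-≤-trans (sum-strict (proj₂ (∈-between⁻ m i∈))) m≤n)) 𝟎)
          (sym (familySum≡adjoinFamily m I)))

mainTheorem8 : ∀ {c ℓ} (q : ℕ) → IsPrimePower q → (F : FiniteField q c ℓ) →
    (k : ℕ) → 1 ≤ k →
    Counts F k ×
    ((counts : Counts F k) → let open Counts counts in
    (∀ m → 𝟎 <ᵛ m → + I m ≡ + N m - + familySum I m) ×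
    I 𝟎 ≡ 0 ×
    (∀ (J : Vec ℕ k → ℕ) → J 𝟎 ≡ 0 →
    (∀ m → 𝟎 <ᵛ m → + J m ≡ + N m - + familySum J m) →
    ∀ m → J m ≡ I m))
mainTheorem8 q _ F k _ = Counting.counts F k , λ counts →
  (λ m _ → Counting.I-formula F k counts m) , Counting.I-𝟎 F k counts , Counting.recursion-unique F k counts
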